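{- For every pair of integers $r\ge 2$ and $m\ge 1$, there exist a finite set $V$ and an admissible function $w:2^V\to\mathbb{R}_{\ge0}$ such that $$\delta(w)\le\frac1m+\frac{m-1}{mr}.$$
   Context: Let $V$ be a finite set and $2^V$ its power set. A function $w:2^V\to\mathbb{R}_{\ge0}$ is called admissible if it is not identically zero, $w(\varnothing)=0$, and $w(A\cup B)\ge\min\{w(A),w(B)\}$ for all $A,B\subseteq V$. For an admissible $w$ and $x\in V$ put $p_x(w)=\dfrac{\sum_{A\subseteq V,\,x\in A}w(A)}{\sum_{A\subseteq V}w(A)}$, and $\delta(w)=\max_{x\in V}p_x(w)$. (An admissible function can exist only if $V\neq\varnothing$.) -}

module Defs where

open import Data.Empty using (⊥-elim)
open import Data.Fin using (Fin; zero; suc)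
open import Data.Fin.Subset using (Subset; inside; outside; _∈_; _∪_) renaming (⊥ to ∅)
open import Data.Fin.Subset.Properties using (_∈?_)
open import Data.Integer as ℤ using (ℤ; +_)
open import Data.List using (List; []; _∷_; _++_; map; filter; foldr)
open import Data.List.Membership.Propositional using () renaming (_∈_ to _∈ˡ_)
open import Data.List.Membership.Propositional.Properties using (∈-map⁺; ∈-++⁺ˡ; ∈-++⁺ʳ)
open import Data.List.Relation.Unary.Any using (here; there)
open import Data.Nat as ℕ using (ℕ; zero; suc)
import Data.Nat.Properties as ℕₚ
open import Data.Product using (Σ; ∃; _×_; _,_; proj₁; proj₂)
open import Data.Rational as ℚ using (ℚ; 0ℚ; 1ℚ; ½; ∣_∣; NonNegative)
import Data.Rational.Properties as ℚₚ
open import Data.Rational.Solver using (module +-*-Solver)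
open import Data.Sum using (_⊎_; inj₁; inj₂; [_,_]′)
open import Data.Vec as Vec using ([]; _∷_)
open import Relation.Binary.PropositionalEquality
open import Relation.Nullary using (¬_; yes; no; contradiction)

open +-*-Solver using (solve; _:=_; _:+_; _:*_; _:-_; :-_; con)

private
  <⇒≱ : ∀ {p q} → p ℚ.< q → ¬ (q ℚ.≤ p)
  <⇒≱ p<q q≤p = ℚₚ.<-irrefl refl (ℚₚ.<-≤-trans p<q q≤p)

  half+half : ∀ e → ½ ℚ.* e ℚ.+ ½ ℚ.* e ≡ e
  half+half e = trans (sym (ℚₚ.*-distribʳ-+ e ½ ½)) (ℚₚ.*-identityˡ e)

  half>0 : ∀ {e} → 0ℚ ℚ.< e → 0ℚ ℚ.< ½ ℚ.* e
  half>0 {e} e>0 =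
    subst (ℚ._< ½ ℚ.* e) (ℚₚ.*-zeroʳ ½) (ℚₚ.*-monoʳ-<-pos ½ e>0)

  *-pos : ∀ {p q} → 0ℚ ℚ.< p → 0ℚ ℚ.< q → 0ℚ ℚ.< p ℚ.* q
  *-pos {p} {q} p>0 q>0 =
    subst (ℚ._< p ℚ.* q) (ℚₚ.*-zeroʳ p)
      (ℚₚ.*-monoʳ-<-pos p {{ℚ.positive p>0}} q>0)

  *-mono-nonNeg : ∀ {p q r s} → 0ℚ ℚ.≤ q → 0ℚ ℚ.≤ r →
                  p ℚ.≤ q → r ℚ.≤ s → p ℚ.* r ℚ.≤ q ℚ.* s
  *-mono-nonNeg {p} {q} {r} {s} q≥0 r≥0 p≤q r≤s = ℚₚ.≤-trans
    (ℚₚ.*-monoʳ-≤-nonNeg r {{ℚ.nonNegative r≥0}} p≤q)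
    (ℚₚ.*-monoˡ-≤-nonNeg q {{ℚ.nonNegative q≥0}} r≤s)

  p≤∣p∣ : ∀ p → p ℚ.≤ ∣ p ∣
  p≤∣p∣ p with ℚₚ.≤-total 0ℚ p
  ... | inj₁ 0≤p = ℚₚ.≤-reflexive (sym (ℚₚ.0≤p⇒∣p∣≡p 0≤p))
  ... | inj₂ p≤0 = ℚₚ.≤-trans p≤0 (ℚₚ.0≤∣p∣ p)

  ∣∣-least : ∀ {p e} → p ℚ.≤ e → ℚ.- p ℚ.≤ e → ∣ p ∣ ℚ.≤ e
  ∣∣-least {p} {e} h k with ℚₚ.∣p∣≡p∨∣p∣≡-p p
  ... | inj₁ eq = subst (ℚ._≤ e) (sym eq) h
  ... | inj₂ eq = subst (ℚ._≤ e) (sym eq) k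

  swap : ∀ p q → ℚ.- (p ℚ.- q) ≡ q ℚ.- p
  swap = solve 2 (λ p q → :- (p :- q) := q :- p) refl

  ≤+⇒-≤ : ∀ {p q e} → p ℚ.≤ q ℚ.+ e → p ℚ.- q ℚ.≤ e
  ≤+⇒-≤ {p} {q} {e} h =
    subst (p ℚ.- q ℚ.≤_) (solve 2 (λ q e → (q :+ e) :- q := e) refl q e)
      (ℚₚ.+-monoˡ-≤ (ℚ.- q) h)

  -≤⇒≤+ : ∀ {p q e} → p ℚ.- q ℚ.≤ e → p ℚ.≤ q ℚ.+ e
  -≤⇒≤+ {p} {q} {e} h =
    subst (ℚ._≤ q ℚ.+ e) (solve 2 (λ p q → q :+ (p :- q) := p) refl p q)
      (ℚₚ.+-monoʳ-≤ q h)

  close : ∀ {p q e} → p ℚ.≤ q ℚ.+ e → q ℚ.≤ p ℚ.+ e → ∣ p ℚ.- q ∣ ℚ.≤ e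
  close {p} {q} {e} h k =
    ∣∣-least (≤+⇒-≤ h) (subst (ℚ._≤ e) (sym (swap p q)) (≤+⇒-≤ k))

  closeˡ : ∀ {p q e} → ∣ p ℚ.- q ∣ ℚ.≤ e → p ℚ.≤ q ℚ.+ e
  closeˡ {p} {q} h = -≤⇒≤+ (ℚₚ.≤-trans (p≤∣p∣ (p ℚ.- q)) h)

  ∣-∣-comm : ∀ p q → ∣ p ℚ.- q ∣ ≡ ∣ q ℚ.- p ∣
  ∣-∣-comm p q = trans (sym (ℚₚ.∣-p∣≡∣p∣ (p ℚ.- q))) (cong ∣_∣ (swap p q))

  closeʳ : ∀ {p q e} → ∣ p ℚ.- q ∣ ℚ.≤ e → q ℚ.≤ p ℚ.+ e
  closeʳ {p} {q} {e} h = closeˡ (subst (ℚ._≤ e) (∣-∣-comm p q) h)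

  ⊔-shift : ∀ {a b c d e} → a ℚ.≤ c ℚ.+ e → b ℚ.≤ d ℚ.+ e →
            a ℚ.⊔ b ℚ.≤ (c ℚ.⊔ d) ℚ.+ e
  ⊔-shift {a} {b} {c} {d} {e} h k = ℚₚ.⊔-lub
    (ℚₚ.≤-trans h (ℚₚ.+-monoˡ-≤ e (ℚₚ.p≤p⊔q c d)))
    (ℚₚ.≤-trans k (ℚₚ.+-monoˡ-≤ e (ℚₚ.p≤q⊔p c d)))

  ⊓-shift : ∀ {a b c d e} → a ℚ.≤ c ℚ.+ e → b ℚ.≤ d ℚ.+ e →
            a ℚ.⊓ b ℚ.≤ (c ℚ.⊓ d) ℚ.+ e
  ⊓-shift {a} {b} {c} {d} {e} h k with ℚₚ.≤-total c d
  ... | inj₁ c≤d rewrite ℚₚ.p≤q⇒p⊓q≡p c≤d = ℚₚ.≤-trans (ℚₚ.p⊓q≤p a b) h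
  ... | inj₂ d≤c rewrite ℚₚ.p≥q⇒p⊓q≡q d≤c = ℚₚ.≤-trans (ℚₚ.p⊓q≤q a b) k

  ⊔-close : ∀ a b c d {e} → ∣ a ℚ.- c ∣ ℚ.≤ e → ∣ b ℚ.- d ∣ ℚ.≤ e →
            ∣ (a ℚ.⊔ b) ℚ.- (c ℚ.⊔ d) ∣ ℚ.≤ e
  ⊔-close a b c d h k = close
    (⊔-shift {a} {b} {c} {d} (closeˡ {a} h) (closeˡ {b} k))
    (⊔-shift {c} {d} {a} {b} (closeʳ {a} h) (closeʳ {b} k))

  ⊓-close : ∀ a b c d {e} → ∣ a ℚ.- c ∣ ℚ.≤ e → ∣ b ℚ.- d ∣ ℚ.≤ e →
            ∣ (a ℚ.⊓ b) ℚ.- (c ℚ.⊓ d) ∣ ℚ.≤ e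
  ⊓-close a b c d h k = close
    (⊓-shift {a} {b} {c} {d} (closeˡ {a} h) (closeˡ {b} k))
    (⊓-shift {c} {d} {a} {b} (closeʳ {a} h) (closeʳ {b} k))

-- With inv 0 = 0; the reciprocal of a real apart from 0 takes inv of a sequence
-- that is eventually nonzero, so this value does not affect it.
inv : ℚ → ℚ
inv q with q ℚₚ.≟ 0ℚ
... | yes _  = 0ℚ
... | no q≢0 = ℚ.1/_ q {{ℚ.≢-nonZero q≢0}}

inv-inverse : ∀ q → q ≢ 0ℚ → inv q ℚ.* q ≡ 1ℚ
inv-inverse q q≢0 with q ℚₚ.≟ 0ℚ
... | yes q≡0 = contradiction q≡0 q≢0
... | no  q≢0 = ℚₚ.*-inverseˡ q {{ℚ.≢-nonZero q≢0}}

private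
  away≢0 : ∀ {c q} → 0ℚ ℚ.< c → c ℚ.≤ ∣ q ∣ → q ≢ 0ℚ
  away≢0 {c} c>0 c≤∣q∣ refl = <⇒≱ c>0 c≤∣q∣

  inv-bound : ∀ {c q} → 0ℚ ℚ.< c → c ℚ.≤ ∣ q ∣ → ∣ inv q ∣ ℚ.≤ inv c
  inv-bound {c} {q} c>0 c≤∣q∣ =
    ℚₚ.*-cancelʳ-≤-pos c {{ℚ.positive c>0}} (begin
      ∣ inv q ∣ ℚ.* c      ≤⟨ ℚₚ.*-monoˡ-≤-nonNeg ∣ inv q ∣ {{ℚₚ.∣-∣-nonNeg (inv q)}} c≤∣q∣ ⟩
      ∣ inv q ∣ ℚ.* ∣ q ∣  ≡⟨ ℚₚ.∣p*q∣≡∣p∣*∣q∣ (inv q) q ⟨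
      ∣ inv q ℚ.* q ∣      ≡⟨ cong ∣_∣ (inv-inverse q (away≢0 c>0 c≤∣q∣)) ⟩
      1ℚ                   ≡⟨ inv-inverse c (λ c≡0 → ℚₚ.<⇒≢ c>0 (sym c≡0)) ⟨
      inv c ℚ.* c          ∎)
    where open ℚₚ.≤-Reasoning

  inv-diff : ∀ {c p q} → 0ℚ ℚ.< c → c ℚ.≤ ∣ p ∣ → c ℚ.≤ ∣ q ∣ →
             ∣ inv p ℚ.- inv q ∣ ℚ.≤ (inv c ℚ.* inv c) ℚ.* ∣ p ℚ.- q ∣
  inv-diff {c} {p} {q} c>0 hp hq = begin
    ∣ inv p ℚ.- inv q ∣
      ≡⟨ cong ∣_∣ (cong₂ ℚ._-_ (sym (ℚₚ.*-identityʳ (inv p))) (sym (ℚₚ.*-identityʳ (inv q)))) ⟩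
    ∣ inv p ℚ.* 1ℚ ℚ.- inv q ℚ.* 1ℚ ∣
      ≡⟨ cong ∣_∣ (cong₂ (λ s t → inv p ℚ.* s ℚ.- inv q ℚ.* t)
           (inv-inverse q (away≢0 c>0 hq)) (inv-inverse p (away≢0 c>0 hp))) ⟨
    ∣ inv p ℚ.* (inv q ℚ.* q) ℚ.- inv q ℚ.* (inv p ℚ.* p) ∣
      ≡⟨ cong ∣_∣ (solve 4 (λ a b p q → a :* (b :* q) :- b :* (a :* p) := (a :* b) :* (q :- p))
           refl (inv p) (inv q) p q) ⟩
    ∣ (inv p ℚ.* inv q) ℚ.* (q ℚ.- p) ∣
      ≡⟨ ℚₚ.∣p*q∣≡∣p∣*∣q∣ (inv p ℚ.* inv q) (q ℚ.- p) ⟩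
    ∣ inv p ℚ.* inv q ∣ ℚ.* ∣ q ℚ.- p ∣
      ≡⟨ cong₂ ℚ._*_ (ℚₚ.∣p*q∣≡∣p∣*∣q∣ (inv p) (inv q)) (∣-∣-comm q p) ⟩
    (∣ inv p ∣ ℚ.* ∣ inv q ∣) ℚ.* ∣ p ℚ.- q ∣
      ≤⟨ ℚₚ.*-monoʳ-≤-nonNeg ∣ p ℚ.- q ∣ {{ℚₚ.∣-∣-nonNeg (p ℚ.- q)}}
           (*-mono-nonNeg (ℚₚ.≤-trans (ℚₚ.0≤∣p∣ (inv p)) (inv-bound {q = p} c>0 hp))
             (ℚₚ.0≤∣p∣ (inv q)) (inv-bound {q = p} c>0 hp) (inv-bound {q = q} c>0 hq)) ⟩
    (inv c ℚ.* inv c) ℚ.* ∣ p ℚ.- q ∣ ∎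
    where open ℚₚ.≤-Reasoning

  inv>0 : ∀ {c} → 0ℚ ℚ.< c → 0ℚ ℚ.< inv c
  inv>0 {c} c>0 with c ℚₚ.≟ 0ℚ
  ... | yes c≡0 = contradiction (sym c≡0) (ℚₚ.<⇒≢ c>0)
  ... | no  c≢0 = ℚₚ.positive⁻¹ _ {{ℚₚ.1/pos⇒pos c {{ℚ.positive c>0}}}}

  scale : ∀ {b e} → 0ℚ ℚ.< b → b ℚ.* (inv b ℚ.* e) ≡ e
  scale {b} {e} b>0 = begin
    b ℚ.* (inv b ℚ.* e)  ≡⟨ solve 3 (λ b i e → b :* (i :* e) := (i :* b) :* e) refl b (inv b) e ⟩
    (inv b ℚ.* b) ℚ.* e  ≡⟨ cong (ℚ._* e) (inv-inverse b (λ b≡0 → ℚₚ.<⇒≢ b>0 (sym b≡0))) ⟩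
    1ℚ ℚ.* e             ≡⟨ ℚₚ.*-identityˡ e ⟩
    e                    ∎
    where open ≡-Reasoning

Eventually : (ℕ → Set) → Set
Eventually P = ∃ λ N → ∀ n → N ℕ.≤ n → P n

private
  always : ∀ {P : ℕ → Set} → (∀ n → P n) → Eventually P
  always p = 0 , λ n _ → p n

  ev-map₂ : ∀ {P Q R : ℕ → Set} → (∀ {n} → P n → Q n → R n) →
            Eventually P → Eventually Q → Eventually R
  ev-map₂ f (M , p) (N , q) = M ℕ.⊔ N , λ n le →
    f (p n (ℕₚ.≤-trans (ℕₚ.m≤m⊔n M N) le)) (q n (ℕₚ.≤-trans (ℕₚ.m≤n⊔m M N) le))

Cauchy : (ℕ → ℚ) → Set
Cauchy s = ∀ ε → 0ℚ ℚ.< ε →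
  ∃ λ N → ∀ m n → N ℕ.≤ m → N ℕ.≤ n → ∣ s m ℚ.- s n ∣ ℚ.≤ ε

-- Real numbers are Cauchy sequences of rationals up to _≃_, which plays the role
-- of equality.
record ℝ : Set where
  constructor mkℝ
  field
    seq    : ℕ → ℚ
    cauchy : Cauchy seq

open ℝ public

infix 4 _≃_ _≤_ _<_ _#_

_≃_ : ℝ → ℝ → Set
x ≃ y = ∀ ε → 0ℚ ℚ.< ε → Eventually λ n → ∣ seq x n ℚ.- seq y n ∣ ℚ.≤ ε

_≤_ : ℝ → ℝ → Set
x ≤ y = ∀ ε → 0ℚ ℚ.< ε → Eventually λ n → seq x n ℚ.≤ seq y n ℚ.+ ε

_<_ : ℝ → ℝ → Set
x < y = ∃ λ ε → 0ℚ ℚ.< ε × Eventually λ n → seq x n ℚ.+ ε ℚ.≤ seq y n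

-- Apartness, the constructive form of x ≠ y.
_#_ : ℝ → ℝ → Set
x # y = x < y ⊎ y < x

fromℚ : ℚ → ℝ
fromℚ q = mkℝ (λ _ → q) λ ε ε>0 → 0 , λ _ _ _ _ →
  subst (ℚ._≤ ε) (sym (cong ∣_∣ (ℚₚ.+-inverseʳ q))) (ℚₚ.<⇒≤ ε>0)

0ℝ : ℝ
0ℝ = fromℚ 0ℚ

infixl 6 _+_
infixl 7 _*_ _/_

_+_ : ℝ → ℝ → ℝ
mkℝ s cs + mkℝ t ct = mkℝ (λ n → s n ℚ.+ t n) λ ε ε>0 →
  let M , hs = cs (½ ℚ.* ε) (half>0 ε>0)
      N , ht = ct (½ ℚ.* ε) (half>0 ε>0)
  in M ℕ.⊔ N , λ m n lm ln → begin
    ∣ (s m ℚ.+ t m) ℚ.- (s n ℚ.+ t n) ∣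
      ≡⟨ cong ∣_∣ (solve 4 (λ a b c d → (a :+ b) :- (c :+ d) := (a :- c) :+ (b :- d))
           refl (s m) (t m) (s n) (t n)) ⟩
    ∣ (s m ℚ.- s n) ℚ.+ (t m ℚ.- t n) ∣
      ≤⟨ ℚₚ.∣p+q∣≤∣p∣+∣q∣ (s m ℚ.- s n) (t m ℚ.- t n) ⟩
    ∣ s m ℚ.- s n ∣ ℚ.+ ∣ t m ℚ.- t n ∣
      ≤⟨ ℚₚ.+-mono-≤ (hs m n (ℕₚ.m⊔n≤o⇒m≤o M N lm) (ℕₚ.m⊔n≤o⇒m≤o M N ln))
                     (ht m n (ℕₚ.m⊔n≤o⇒n≤o M N lm) (ℕₚ.m⊔n≤o⇒n≤o M N ln)) ⟩
    ½ ℚ.* ε ℚ.+ ½ ℚ.* ε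
      ≡⟨ half+half ε ⟩
    ε ∎
  where open ℚₚ.≤-Reasoning

private
  bounded : ∀ {s} → Cauchy s →
            ∃ λ B → 0ℚ ℚ.< B × Eventually λ n → ∣ s n ∣ ℚ.≤ B
  bounded {s} cs =
    let N , h = cs 1ℚ (ℚₚ.positive⁻¹ 1ℚ)
    in 1ℚ ℚ.+ ∣ s N ∣
     , ℚₚ.+-mono-<-≤ (ℚₚ.positive⁻¹ 1ℚ) (ℚₚ.0≤∣p∣ (s N))
     , N , λ n ln → begin
         ∣ s n ∣
           ≡⟨ cong ∣_∣ (solve 2 (λ a b → a := (a :- b) :+ b) refl (s n) (s N)) ⟩
         ∣ (s n ℚ.- s N) ℚ.+ s N ∣
           ≤⟨ ℚₚ.∣p+q∣≤∣p∣+∣q∣ (s n ℚ.- s N) (s N) ⟩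
         ∣ s n ℚ.- s N ∣ ℚ.+ ∣ s N ∣
           ≤⟨ ℚₚ.+-monoˡ-≤ ∣ s N ∣ (h n N ln ℕₚ.≤-refl) ⟩
         1ℚ ℚ.+ ∣ s N ∣ ∎
    where open ℚₚ.≤-Reasoning

_*_ : ℝ → ℝ → ℝ
mkℝ s cs * mkℝ t ct = mkℝ (λ n → s n ℚ.* t n) λ ε ε>0 →
  let A , A>0 , K , ha = bounded {s} cs
      B , B>0 , L , hb = bounded {t} ct
      A+B>0 = ℚₚ.+-mono-< A>0 B>0
      η   = inv (A ℚ.+ B) ℚ.* ε
      η>0 = *-pos (inv>0 A+B>0) ε>0
      M , hs = cs η η>0
      N , ht = ct η η>0
  in (K ℕ.⊔ L) ℕ.⊔ (M ℕ.⊔ N) , λ m n lm ln →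
    let lK = ℕₚ.m⊔n≤o⇒m≤o K L (ℕₚ.m⊔n≤o⇒m≤o (K ℕ.⊔ L) (M ℕ.⊔ N) lm)
        lL = ℕₚ.m⊔n≤o⇒n≤o K L (ℕₚ.m⊔n≤o⇒m≤o (K ℕ.⊔ L) (M ℕ.⊔ N) ln)
        lm′ = ℕₚ.m⊔n≤o⇒n≤o (K ℕ.⊔ L) (M ℕ.⊔ N) lm
        ln′ = ℕₚ.m⊔n≤o⇒n≤o (K ℕ.⊔ L) (M ℕ.⊔ N) ln
        es = hs m n (ℕₚ.m⊔n≤o⇒m≤o M N lm′) (ℕₚ.m⊔n≤o⇒m≤o M N ln′)
        et = ht m n (ℕₚ.m⊔n≤o⇒n≤o M N lm′) (ℕₚ.m⊔n≤o⇒n≤o M N ln′)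
    in begin
      ∣ s m ℚ.* t m ℚ.- s n ℚ.* t n ∣
        ≡⟨ cong ∣_∣ (solve 4 (λ a b c d → a :* b :- c :* d := a :* (b :- d) :+ d :* (a :- c))
             refl (s m) (t m) (s n) (t n)) ⟩
      ∣ s m ℚ.* (t m ℚ.- t n) ℚ.+ t n ℚ.* (s m ℚ.- s n) ∣
        ≤⟨ ℚₚ.∣p+q∣≤∣p∣+∣q∣ (s m ℚ.* (t m ℚ.- t n)) (t n ℚ.* (s m ℚ.- s n)) ⟩
      ∣ s m ℚ.* (t m ℚ.- t n) ∣ ℚ.+ ∣ t n ℚ.* (s m ℚ.- s n) ∣
        ≡⟨ cong₂ ℚ._+_ (ℚₚ.∣p*q∣≡∣p∣*∣q∣ (s m) (t m ℚ.- t n))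
                       (ℚₚ.∣p*q∣≡∣p∣*∣q∣ (t n) (s m ℚ.- s n)) ⟩
      ∣ s m ∣ ℚ.* ∣ t m ℚ.- t n ∣ ℚ.+ ∣ t n ∣ ℚ.* ∣ s m ℚ.- s n ∣
        ≤⟨ ℚₚ.+-mono-≤
             (*-mono-nonNeg (ℚₚ.<⇒≤ A>0) (ℚₚ.0≤∣p∣ (t m ℚ.- t n)) (ha m lK) et)
             (*-mono-nonNeg (ℚₚ.<⇒≤ B>0) (ℚₚ.0≤∣p∣ (s m ℚ.- s n)) (hb n lL) es) ⟩
      A ℚ.* η ℚ.+ B ℚ.* η
        ≡⟨ ℚₚ.*-distribʳ-+ η A B ⟨
      (A ℚ.+ B) ℚ.* η
        ≡⟨ scale A+B>0 ⟩
      ε ∎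
  where open ℚₚ.≤-Reasoning

private
  apart : ∀ {y} → y # 0ℝ → ∃ λ c → 0ℚ ℚ.< c × Eventually λ n → c ℚ.≤ ∣ seq y n ∣
  apart {y} (inj₁ (c , c>0 , N , h)) = c , c>0 , N , λ n ln → ℚₚ.≤-trans
    (subst₂ ℚ._≤_ (solve 2 (λ a c → (:- a) :+ (a :+ c) := c) refl (seq y n) c)
                  (ℚₚ.+-identityʳ (ℚ.- seq y n))
      (ℚₚ.+-monoʳ-≤ (ℚ.- seq y n) (h n ln)))
    (subst (ℚ.- seq y n ℚ.≤_) (ℚₚ.∣-p∣≡∣p∣ (seq y n)) (p≤∣p∣ (ℚ.- seq y n)))
  apart {y} (inj₂ (c , c>0 , N , h)) = c , c>0 , N , λ n ln → ℚₚ.≤-trans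
    (subst (ℚ._≤ seq y n) (ℚₚ.+-identityˡ c) (h n ln)) (p≤∣p∣ (seq y n))

recip : (y : ℝ) → y # 0ℝ → ℝ
recip y y#0 = mkℝ (λ n → inv (seq y n)) λ ε ε>0 →
  let c , c>0 , M , hc = apart {y} y#0
      b   = inv c ℚ.* inv c
      b>0 = *-pos (inv>0 c>0) (inv>0 c>0)
      N , hy = cauchy y (inv b ℚ.* ε) (*-pos (inv>0 b>0) ε>0)
  in M ℕ.⊔ N , λ m n lm ln → begin
    ∣ inv (seq y m) ℚ.- inv (seq y n) ∣
      ≤⟨ inv-diff {p = seq y m} {q = seq y n} c>0
           (hc m (ℕₚ.m⊔n≤o⇒m≤o M N lm)) (hc n (ℕₚ.m⊔n≤o⇒m≤o M N ln)) ⟩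
    b ℚ.* ∣ seq y m ℚ.- seq y n ∣
      ≤⟨ ℚₚ.*-monoˡ-≤-nonNeg b {{ℚ.nonNegative (ℚₚ.<⇒≤ b>0)}}
           (hy m n (ℕₚ.m⊔n≤o⇒n≤o M N lm) (ℕₚ.m⊔n≤o⇒n≤o M N ln)) ⟩
    b ℚ.* (inv b ℚ.* ε)
      ≡⟨ scale b>0 ⟩
    ε ∎
  where open ℚₚ.≤-Reasoning

_/_ : (x y : ℝ) {y#0 : y # 0ℝ} → ℝ
_/_ x y {y#0} = x * recip y y#0

_⊔_ : ℝ → ℝ → ℝ
mkℝ s cs ⊔ mkℝ t ct = mkℝ (λ n → s n ℚ.⊔ t n) λ ε ε>0 →
  let M , hs = cs ε ε>0
      N , ht = ct ε ε>0
  in M ℕ.⊔ N , λ m n lm ln →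
    let es = hs m n (ℕₚ.m⊔n≤o⇒m≤o M N lm) (ℕₚ.m⊔n≤o⇒m≤o M N ln)
        et = ht m n (ℕₚ.m⊔n≤o⇒n≤o M N lm) (ℕₚ.m⊔n≤o⇒n≤o M N ln)
    in ⊔-close (s m) (t m) (s n) (t n) es et

_⊓_ : ℝ → ℝ → ℝ
mkℝ s cs ⊓ mkℝ t ct = mkℝ (λ n → s n ℚ.⊓ t n) λ ε ε>0 →
  let M , hs = cs ε ε>0
      N , ht = ct ε ε>0
  in M ℕ.⊔ N , λ m n lm ln →
    let es = hs m n (ℕₚ.m⊔n≤o⇒m≤o M N lm) (ℕₚ.m⊔n≤o⇒m≤o M N ln)
        et = ht m n (ℕₚ.m⊔n≤o⇒n≤o M N lm) (ℕₚ.m⊔n≤o⇒n≤o M N ln)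
    in ⊓-close (s m) (t m) (s n) (t n) es et

private
  0≤+0≤ : ∀ {x y} → 0ℝ ≤ x → 0ℝ ≤ y → 0ℝ ≤ x + y
  0≤+0≤ {x} {y} hx hy ε ε>0 =
    ev-map₂ (λ {n} p q → subst (0ℚ ℚ.≤_)
        (trans (solve 3 (λ a b h → (a :+ h) :+ (b :+ h) := (a :+ b) :+ (h :+ h)) refl
                 (seq x n) (seq y n) (½ ℚ.* ε))
               (cong (seq x n ℚ.+ seq y n ℚ.+_) (half+half ε)))
        (ℚₚ.+-mono-≤ p q))
      (hx (½ ℚ.* ε) (half>0 ε>0)) (hy (½ ℚ.* ε) (half>0 ε>0))

  0<+0≤ : ∀ {x y} → 0ℝ < x → 0ℝ ≤ y → 0ℝ < x + y
  0<+0≤ {x} {y} (c , c>0 , hx) hy = ½ ℚ.* c , half>0 c>0 ,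
    ev-map₂ (λ {n} p q →
        subst₂ ℚ._≤_ (sym (ℚₚ.+-identityˡ (½ ℚ.* c)))
          (solve 3 (λ a b h → (a :- h) :+ (b :+ h) := a :+ b) refl
            (seq x n) (seq y n) (½ ℚ.* c))
          (subst (ℚ._≤ (seq x n ℚ.- ½ ℚ.* c) ℚ.+ (seq y n ℚ.+ ½ ℚ.* c))
            (ℚₚ.+-identityʳ (½ ℚ.* c))
            (ℚₚ.+-mono-≤
              (subst (ℚ._≤ seq x n ℚ.- ½ ℚ.* c)
                (trans (cong (ℚ._- ½ ℚ.* c) (trans (ℚₚ.+-identityˡ c) (sym (half+half c))))
                       (solve 1 (λ h → (h :+ h) :- h := h) refl (½ ℚ.* c)))
                (ℚₚ.+-monoˡ-≤ (ℚ.- (½ ℚ.* c)) p))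
              q)))
      hx (hy (½ ℚ.* c) (half>0 c>0))

  0≤+0< : ∀ {x y} → 0ℝ ≤ x → 0ℝ < y → 0ℝ < x + y
  0≤+0< {x} {y} hx hy =
    let c , c>0 , N , h = 0<+0≤ {y} {x} hy hx
    in c , c>0 , N , λ n ln →
         subst (0ℚ ℚ.+ c ℚ.≤_) (ℚₚ.+-comm (seq y n) (seq x n)) (h n ln)

  0≤∧#0⇒0< : ∀ {x} → 0ℝ ≤ x → x # 0ℝ → 0ℝ < x
  0≤∧#0⇒0< h (inj₂ pos) = pos
  0≤∧#0⇒0< {x} h (inj₁ (c , c>0 , M , neg)) =
    let N , p = h (½ ℚ.* c) (half>0 c>0)
        k = M ℕ.⊔ N
    in contradiction
         (ℚₚ.≤-trans
           (subst (ℚ._≤ seq x k ℚ.+ c) (ℚₚ.+-identityˡ (½ ℚ.* c))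
             (subst (0ℚ ℚ.+ ½ ℚ.* c ℚ.≤_)
               (trans (ℚₚ.+-assoc (seq x k) (½ ℚ.* c) (½ ℚ.* c))
                      (cong (seq x k ℚ.+_) (half+half c)))
               (ℚₚ.+-monoˡ-≤ (½ ℚ.* c) (p k (ℕₚ.m≤n⊔m M N)))))
           (neg k (ℕₚ.m≤m⊔n M N)))
         (<⇒≱ (half>0 c>0))

  ≃0⇒¬#0 : ∀ {x} → x ≃ 0ℝ → ¬ (x # 0ℝ)
  ≃0⇒¬#0 {x} x≃0 x#0 =
    let c , c>0 , M , h = apart {x} x#0
        N , p = x≃0 (½ ℚ.* c) (half>0 c>0)
        k = M ℕ.⊔ N
        c≤½c = ℚₚ.≤-trans (h k (ℕₚ.m≤m⊔n M N))
                 (subst (ℚ._≤ ½ ℚ.* c) (cong ∣_∣ (ℚₚ.+-identityʳ (seq x k)))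
                   (p k (ℕₚ.m≤n⊔m M N)))
        ½c<c = subst₂ ℚ._<_ (ℚₚ.+-identityʳ (½ ℚ.* c)) (half+half c)
                 (ℚₚ.+-monoʳ-< (½ ℚ.* c) (half>0 c>0))
    in <⇒≱ ½c<c c≤½c

sum : List ℝ → ℝ
sum = foldr _+_ 0ℝ

private
  0≤0 : 0ℝ ≤ 0ℝ
  0≤0 ε ε>0 = always λ _ → subst (0ℚ ℚ.≤_) (sym (ℚₚ.+-identityˡ ε)) (ℚₚ.<⇒≤ ε>0)

  module _ {A : Set} {f : A → ℝ} (f≥0 : ∀ a → 0ℝ ≤ f a) where

    sum≥0 : ∀ as → 0ℝ ≤ sum (map f as)
    sum≥0 []       = 0≤0
    sum≥0 (a ∷ as) = 0≤+0≤ {f a} {sum (map f as)} (f≥0 a) (sum≥0 as)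

    sum>0 : ∀ {a as} → a ∈ˡ as → 0ℝ < f a → 0ℝ < sum (map f as)
    sum>0 {a} {_ ∷ as} (here refl) pos = 0<+0≤ {f a} {sum (map f as)} pos (sum≥0 as)
    sum>0 {_} {b ∷ as} (there a∈)  pos = 0≤+0< {f b} {sum (map f as)} (f≥0 b) (sum>0 a∈ pos)

subsets : ∀ n → List (Subset n)
subsets zero    = [] ∷ []
subsets (suc n) = map (outside ∷_) (subsets n) ++ map (inside ∷_) (subsets n)

subsets-complete : ∀ {n} (A : Subset n) → A ∈ˡ subsets n
subsets-complete []            = here refl
subsets-complete (outside ∷ A) = ∈-++⁺ˡ (∈-map⁺ (outside ∷_) (subsets-complete A))
subsets-complete (inside  ∷ A) =
  ∈-++⁺ʳ (map (outside ∷_) (subsets _)) (∈-map⁺ (inside ∷_) (subsets-complete A))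

-- "Not identically zero" is expressed by apartness (nonzero), since the division
-- by the total weight requires a positive lower bound on that total.
record Admissible {n : ℕ} (w : Subset n → ℝ) : Set where
  field
    nonneg  : ∀ A → 0ℝ ≤ w A
    nonzero : ∃ λ A → w A # 0ℝ
    empty   : w ∅ ≃ 0ℝ
    union   : ∀ A B → w A ⊓ w B ≤ w (A ∪ B)

open Admissible public

total : ∀ {n} → (Subset n → ℝ) → ℝ
total {n} w = sum (map w (subsets n))

containing : ∀ {n} → (Subset n → ℝ) → Fin n → ℝ
containing {n} w x = sum (map w (filter (x ∈?_) (subsets n)))

total#0 : ∀ {n} {w : Subset n → ℝ} → Admissible w → total w # 0ℝ
total#0 {w = w} adm =
  let A , wA#0 = nonzero adm
  in inj₂ (sum>0 (nonneg adm) (subsets-complete A) (0≤∧#0⇒0< {w A} (nonneg adm A) wA#0))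

frequency : ∀ {n} (w : Subset n → ℝ) → Admissible w → Fin n → ℝ
frequency w adm x = _/_ (containing w x) (total w) {total#0 adm}

empty-ground : {w : Subset 0 → ℝ} → ¬ Admissible w
empty-ground {w} adm with nonzero adm
... | [] , w∅#0 = ≃0⇒¬#0 {w []} (empty adm) w∅#0

-- The maximum is over a nonempty index set: no admissible w exists for n = 0.
δ : ∀ {n} (w : Subset n → ℝ) → Admissible w → ℝ
δ {zero}  w adm = ⊥-elim (empty-ground adm)
δ {suc n} w adm = Vec.foldr₁ _⊔_ (Vec.tabulate (frequency w adm))

{-# OPTIONS --safe #-}
module Submission where

-- Even δ(w) ≤ 1/m holds for a suitable w, built in M = 3m rounds of equal total weight
-- in which no point is frequent in more than two rounds.  Round t owns a token q t,
-- and every set receiving weight contains some token.  A round adds M blocks of K new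
-- points; each earlier set A is enlarged by the blocks of the tokens it contains, and
-- the new sets consist of the token q t and all new points except one in each block.
-- The union of a new set with another new set or with an enlarged old set misses fewer
-- than M new points.  All sets of this last kind are given the (low) weight of the new
-- sets; there are at most C·K^(M−1) of them against K^M new sets, so for large K
-- their share is negligible.  A point in the block of q s that was added in round t
-- is frequent in rounds s and t only; with the negligible share of each round below
-- 1/M of the round, its frequency is at most 2/M + 1/M = 1/m.

open import Defs
open import Data.Nat as ℕ using (ℕ)
open import Data.Integer as ℤ using (+_; 1ℤ)
open import Data.Rational as ℚ using ()
open import Data.Fin.Subset using (Subset)
open import Data.Nat.Properties using (m*n≢0)
open import Data.Product using (Σ-syntax; ∃-syntax)

open import Data.Bool using (Bool; true; false; _∧_; _∨_) renaming (_≟_ to _≟ᵇ_)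
import Data.Bool.Properties as Boolₚ
open import Data.Empty using (⊥-elim)
open import Data.Fin as Fin using (Fin; zero; suc; toℕ; _↑ˡ_; _↑ʳ_)
import Data.Fin.Properties as Finₚ
open import Data.Fin.Subset as Sub using (inside; outside; _∈_; _∪_; ∁; ⁅_⁆; Nonempty; ∣_∣)
import Data.Fin.Subset.Properties as Subₚ
import Data.Integer.Properties as ℤₚ
open import Data.List as List using (List; []; _∷_)
import Data.List.Properties as Listₚ
open import Data.Nat using (zero; suc)
open import Data.Nat.ListAction using () renaming (sum to sumℕ)
open import Data.Nat.ListAction.Properties using (sum-++)
import Data.Nat.Properties as ℕₚ
open import Data.Nat.Tactic.RingSolver using (solve-∀)
open import Data.Product using (∃; _×_; _,_; proj₁; proj₂)
open import Data.Rational using (ℚ; 0ℚ; 1ℚ)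
import Data.Rational.Properties as ℚₚ
import Data.Rational.Unnormalised as ℚᵘ
import Data.Rational.Unnormalised.Properties as ℚᵘₚ
open import Data.Sum using (_⊎_; inj₁; inj₂)
open import Data.Vec as Vec using ([]; _∷_; _++_; lookup; take; drop)
import Data.Vec.Properties as Vecₚ
open import Function using (_∘_)
open import Relation.Binary.PropositionalEquality
open import Relation.Nullary using (¬_; Dec; yes; no; does; contradiction; _×-dec_; _⊎-dec_)
open import Relation.Nullary.Decidable using (dec-true; decidable-stable)

-- Sums over all subsets of a finite set.

χ : Bool → ℕ
χ true  = 1
χ false = 0

module _ {A : Set} {f g : A → ℕ} where

  sum-map-mono : (∀ a → f a ℕ.≤ g a) → ∀ as → sumℕ (List.map f as) ℕ.≤ sumℕ (List.map g as)
  sum-map-mono f≤g []       = ℕ.z≤n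
  sum-map-mono f≤g (a ∷ as) = ℕₚ.+-mono-≤ (f≤g a) (sum-map-mono f≤g as)

  sum-map-+ : ∀ as → sumℕ (List.map (λ a → f a ℕ.+ g a) as) ≡
                     sumℕ (List.map f as) ℕ.+ sumℕ (List.map g as)
  sum-map-+ []       = refl
  sum-map-+ (a ∷ as) =
    trans (cong (f a ℕ.+ g a ℕ.+_) (sum-map-+ as))
          (interchange (f a) (g a) (sumℕ (List.map f as)) (sumℕ (List.map g as)))
    where
    interchange : ∀ a b c d → (a ℕ.+ b) ℕ.+ (c ℕ.+ d) ≡ (a ℕ.+ c) ℕ.+ (b ℕ.+ d)
    interchange = solve-∀

sum-map-* : ∀ {A : Set} c (f : A → ℕ) as →
            sumℕ (List.map (λ a → c ℕ.* f a) as) ≡ c ℕ.* sumℕ (List.map f as)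
sum-map-* c f []       = sym (ℕₚ.*-zeroʳ c)
sum-map-* c f (a ∷ as) = trans (cong (c ℕ.* f a ℕ.+_) (sum-map-* c f as))
  (sym (ℕₚ.*-distribˡ-+ c (f a) (sumℕ (List.map f as))))

-- Opaque, so that the number of points in ∑ {n} f can be inferred by unification.
opaque

  ∑ : ∀ {n} → (Subset n → ℕ) → ℕ
  ∑ {n} f = sumℕ (List.map f (subsets n))

  ∑-def : ∀ {n} (f : Subset n → ℕ) → ∑ f ≡ sumℕ (List.map f (subsets n))
  ∑-def f = refl

  ∑-mono : ∀ {n} {f g : Subset n → ℕ} → (∀ A → f A ℕ.≤ g A) → ∑ f ℕ.≤ ∑ g
  ∑-mono f≤g = sum-map-mono f≤g (subsets _)

  ∑-cong : ∀ {n} {f g : Subset n → ℕ} → (∀ A → f A ≡ g A) → ∑ f ≡ ∑ g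
  ∑-cong f≡g = cong sumℕ (Listₚ.map-cong f≡g (subsets _))

  ∑-+ : ∀ {n} (f g : Subset n → ℕ) → ∑ (λ A → f A ℕ.+ g A) ≡ ∑ f ℕ.+ ∑ g
  ∑-+ {n} f g = sum-map-+ {f = f} {g} (subsets n)

  ∑-* : ∀ {n} c (f : Subset n → ℕ) → ∑ (λ A → c ℕ.* f A) ≡ c ℕ.* ∑ f
  ∑-* {n} c f = sum-map-* c f (subsets n)

  ∑-[] : (f : Subset 0 → ℕ) → ∑ f ≡ f []
  ∑-[] f = ℕₚ.+-identityʳ (f [])

  ∑-suc : ∀ {n} (f : Subset (suc n) → ℕ) →
          ∑ f ≡ ∑ (λ A → f (outside ∷ A)) ℕ.+ ∑ (λ A → f (inside ∷ A))
  ∑-suc {n} f = begin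
    sumℕ (List.map f (List.map (outside ∷_) S List.++ List.map (inside ∷_) S))
      ≡⟨ cong sumℕ (Listₚ.map-++ f (List.map (outside ∷_) S) (List.map (inside ∷_) S)) ⟩
    sumℕ (List.map f (List.map (outside ∷_) S) List.++ List.map f (List.map (inside ∷_) S))
      ≡⟨ sum-++ (List.map f (List.map (outside ∷_) S)) (List.map f (List.map (inside ∷_) S)) ⟩
    sumℕ (List.map f (List.map (outside ∷_) S)) ℕ.+ sumℕ (List.map f (List.map (inside ∷_) S))
      ≡⟨ cong₂ (λ xs ys → sumℕ xs ℕ.+ sumℕ ys) (Listₚ.map-∘ S) (Listₚ.map-∘ S) ⟨
    sumℕ (List.map (λ A → f (outside ∷ A)) S) ℕ.+ sumℕ (List.map (λ A → f (inside ∷ A)) S) ∎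
    where
    open ≡-Reasoning
    S : List (Subset n)
    S = subsets n

  ∑≢0 : ∀ {n} (f : Subset n → ℕ) → ∑ f ≢ 0 → ∃ λ A → f A ≢ 0
  ∑≢0 {n} f = go (subsets n)
    where
    go : ∀ as → sumℕ (List.map f as) ≢ 0 → ∃ λ A → f A ≢ 0
    go []       0≢0 = ⊥-elim (0≢0 refl)
    go (a ∷ as) s≢0 with f a ℕ.≟ 0
    ... | no fa≢0  = a , fa≢0
    ... | yes fa≡0 = go as (s≢0 ∘ cong₂ ℕ._+_ fa≡0)

∑-++ : ∀ n {k} (f : Subset (n ℕ.+ k) → ℕ) → ∑ f ≡ ∑ {n} λ A → ∑ {k} λ B → f (A ++ B)
∑-++ zero    f = sym (∑-[] _)
∑-++ (suc n) {k} f = begin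
  ∑ f
    ≡⟨ ∑-suc f ⟩
  ∑ (λ C → f (outside ∷ C)) ℕ.+ ∑ (λ C → f (inside ∷ C))
    ≡⟨ cong₂ ℕ._+_ (∑-++ n (λ C → f (outside ∷ C))) (∑-++ n (λ C → f (inside ∷ C))) ⟩
  ∑ {n} (λ A → ∑ {k} λ B → f (outside ∷ A ++ B)) ℕ.+ ∑ {n} (λ A → ∑ {k} λ B → f (inside ∷ A ++ B))
    ≡⟨ ∑-suc (λ A → ∑ {k} λ B → f (A ++ B)) ⟨
  ∑ {suc n} (λ A → ∑ {k} λ B → f (A ++ B)) ∎
  where open ≡-Reasoning

∑-const : ∀ n c → ∑ {n} (λ _ → c) ≡ 2 ℕ.^ n ℕ.* c
∑-const zero    c = trans (∑-[] _) (sym (ℕₚ.*-identityˡ c))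
∑-const (suc n) c = trans (∑-suc {n} (λ _ → c))
  (trans (cong₂ ℕ._+_ (∑-const n c) (∑-const n c)) (double (2 ℕ.^ n) c))
  where
  double : ∀ p c → p ℕ.* c ℕ.+ p ℕ.* c ≡ 2 ℕ.* p ℕ.* c
  double = solve-∀

∑-0 : ∀ n → ∑ {n} (λ _ → 0) ≡ 0
∑-0 n = trans (∑-const n 0) (ℕₚ.*-zeroʳ (2 ℕ.^ n))

infix 4 _≟_

_≟_ : ∀ {n} (A B : Subset n) → Dec (A ≡ B)
_≟_ = Vecₚ.≡-dec _≟ᵇ_

∑-pick : ∀ {n} (C : Subset n) (f : Subset n → ℕ) → ∑ (λ A → χ (does (A ≟ C)) ℕ.* f A) ≡ f C
∑-pick []            f = trans (∑-[] _) (ℕₚ.*-identityˡ (f []))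
∑-pick {suc n} (outside ∷ C) f = trans (∑-suc (λ A → χ (does (A ≟ outside ∷ C)) ℕ.* f A))
  (trans (cong₂ ℕ._+_ (∑-pick C (λ A → f (outside ∷ A))) (∑-0 n)) (ℕₚ.+-identityʳ _))
∑-pick {suc n} (inside ∷ C)  f = trans (∑-suc (λ A → χ (does (A ≟ inside ∷ C)) ℕ.* f A))
  (cong₂ ℕ._+_ (∑-0 n) (∑-pick C (λ A → f (inside ∷ A))))

∑-χ≟ : ∀ {n} (C : Subset n) → ∑ (λ A → χ (does (A ≟ C))) ≡ 1
∑-χ≟ C = trans (∑-cong (λ A → sym (ℕₚ.*-identityʳ (χ (does (A ≟ C)))))) (∑-pick C (λ _ → 1))

-- Counting the points that a set misses.

take-++ : ∀ {n k} (A : Subset n) (B : Subset k) → take n (A ++ B) ≡ A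
take-++ {n} A B = Vecₚ.++-injectiveˡ (take n (A ++ B)) A (Vecₚ.take++drop≡id n (A ++ B))

drop-++ : ∀ {n k} (A : Subset n) (B : Subset k) → drop n (A ++ B) ≡ B
drop-++ {n} A B = Vecₚ.++-injectiveʳ (take n (A ++ B)) A (Vecₚ.take++drop≡id n (A ++ B))

miss : ∀ {n} → Subset n → ℕ
miss B = ∣ ∁ B ∣

miss-++ : ∀ {n k} (A : Subset n) (B : Subset k) → miss (A ++ B) ≡ miss A ℕ.+ miss B
miss-++ []            B = refl
miss-++ (outside ∷ A) B = cong suc (miss-++ A B)
miss-++ (inside  ∷ A) B = miss-++ A B

miss-∪ˡ : ∀ {n} (A B : Subset n) → miss (A ∪ B) ℕ.≤ miss A
miss-∪ˡ []            []            = ℕ.z≤n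
miss-∪ˡ (inside  ∷ A) (_ ∷ B)       = miss-∪ˡ A B
miss-∪ˡ (outside ∷ A) (outside ∷ B) = ℕ.s≤s (miss-∪ˡ A B)
miss-∪ˡ (outside ∷ A) (inside ∷ B)  = ℕₚ.m≤n⇒m≤1+n (miss-∪ˡ A B)

miss-∪ʳ : ∀ {n} (A B : Subset n) → miss (A ∪ B) ℕ.≤ miss B
miss-∪ʳ A B = subst (λ C → miss C ℕ.≤ miss B) (Subₚ.∪-comm B A) (miss-∪ˡ B A)

-- Every point that `B` adds to `A` lowers the count, so an unchanged count leaves no such point.
miss-∪-≡ : ∀ {n} (A B : Subset n) → miss (A ∪ B) ≡ miss A → A ∪ B ≡ A
miss-∪-≡ []            []            eq = refl
miss-∪-≡ (inside  ∷ A) (_ ∷ B)       eq = cong (inside ∷_) (miss-∪-≡ A B eq)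
miss-∪-≡ (outside ∷ A) (outside ∷ B) eq = cong (outside ∷_) (miss-∪-≡ A B (ℕₚ.suc-injective eq))
miss-∪-≡ (outside ∷ A) (inside ∷ B)  eq =
  contradiction (miss-∪ˡ A B) (ℕₚ.<⇒≱ (ℕₚ.≤-reflexive (sym eq)))

miss-⊤∪ : ∀ {n} (B : Subset n) → miss (Vec.replicate n inside ∪ B) ≡ 0
miss-⊤∪ []      = refl
miss-⊤∪ (_ ∷ B) = miss-⊤∪ B

∑-miss≡0 : ∀ n → ∑ {n} (λ B → χ (does (miss B ℕ.≟ 0))) ≡ 1
∑-miss≡0 zero    = ∑-[] _
∑-miss≡0 (suc n) = trans (∑-suc (λ B → χ (does (miss B ℕ.≟ 0)))) (cong₂ ℕ._+_ (∑-0 n) (∑-miss≡0 n))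

∑-miss≡1 : ∀ n → ∑ {n} (λ B → χ (does (miss B ℕ.≟ 1))) ≡ n
∑-miss≡1 zero    = ∑-[] _
∑-miss≡1 (suc n) =
  trans (∑-suc (λ B → χ (does (miss B ℕ.≟ 1)))) (cong₂ ℕ._+_ (∑-miss≡0 n) (∑-miss≡1 n))

-- The sum counts complements of size at most `d`. Splitting on the first point gives Pascal's
-- recursion, and `(n+1)^d + (n+1)^(d+1) = (n+2)(n+1)^d` stays below `(n+2)^(d+1)`. A bound
-- polynomial of degree `d` in the number of points is all that is required later.
few-missing : ∀ n d → ∑ {n} (λ B → χ (does (miss B ℕ.<? suc d))) ℕ.≤ suc n ℕ.^ d
few-missing zero    d = ℕₚ.≤-reflexive (trans (∑-[] _) (sym (ℕₚ.^-zeroˡ d)))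
few-missing (suc n) zero = ℕₚ.≤-trans (ℕₚ.≤-reflexive (∑-suc (λ B → χ (does (miss B ℕ.<? 1)))))
  (ℕₚ.≤-trans (ℕₚ.≤-reflexive (cong (ℕ._+ ∑ {n} (λ B → χ (does (miss B ℕ.<? 1)))) (∑-0 n)))
    (few-missing n zero))
few-missing (suc n) (suc d) = begin
  ∑ (λ B → χ (does (miss B ℕ.<? suc (suc d))))
    ≡⟨ ∑-suc (λ B → χ (does (miss B ℕ.<? suc (suc d)))) ⟩
  ∑ {n} (λ B → χ (does (miss B ℕ.<? suc d))) ℕ.+ ∑ {n} (λ B → χ (does (miss B ℕ.<? suc (suc d))))
    ≤⟨ ℕₚ.+-mono-≤ (few-missing n d) (few-missing n (suc d)) ⟩
  suc n ℕ.^ d ℕ.+ suc n ℕ.^ suc d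
    ≤⟨ ℕₚ.*-monoʳ-≤ (suc (suc n)) (ℕₚ.^-monoˡ-≤ d (ℕₚ.n≤1+n (suc n))) ⟩
  suc (suc n) ℕ.^ suc d ∎
  where open ℕₚ.≤-Reasoning

-- Block structure: blow-ups and cotransversal sets.

blowup : ∀ {M} K → Subset M → Subset (M ℕ.* K)
blowup K a = Vec.concat (Vec.map (Vec.replicate K) a)

blowup-∪ : ∀ {M} K (a b : Subset M) → blowup K (a ∪ b) ≡ blowup K a ∪ blowup K b
blowup-∪ K []      []      = refl
blowup-∪ K (x ∷ a) (y ∷ b) = trans
  (cong₂ _++_ (sym (Vecₚ.zipWith-replicate _∨_ x y)) (blowup-∪ K a b))
  (sym (Vecₚ.zipWith-++ _∨_ (Vec.replicate K x) (blowup K a) (Vec.replicate K y) (blowup K b)))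

lookup-blowup : ∀ {M} K (a : Subset M) z → lookup (blowup K a) z ≡ lookup a (Fin.quotient {M} K z)
lookup-blowup {M} K a z = begin
  lookup (blowup K a) z
    ≡⟨ cong (lookup (blowup K a)) (Finₚ.combine-remQuot {M} K z) ⟨
  lookup (blowup K a) (Fin.combine t k)
    ≡⟨ Vecₚ.lookup-concat (Vec.map (Vec.replicate K) a) t k ⟩
  lookup (lookup (Vec.map (Vec.replicate K) a) t) k
    ≡⟨ cong (λ v → lookup v k) (Vecₚ.lookup-map t (Vec.replicate K) a) ⟩
  lookup (Vec.replicate K (lookup a t)) k
    ≡⟨ Vecₚ.lookup-replicate k (lookup a t) ⟩
  lookup a t ∎
  where
  open ≡-Reasoning
  t = Fin.quotient {M} K z
  k = Fin.remainder {M} K z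

-- The complement of the set has exactly one point in each of the M blocks.
cotransversal : ∀ M {K} → Subset (M ℕ.* K) → Bool
cotransversal zero        B = true
cotransversal (suc M) {K} B = does (miss (take K B) ℕ.≟ 1) ∧ cotransversal M (drop K B)

-- The missed point is chosen among `K` points in each block, independently for the `M` blocks.
∑-cotransversal : ∀ M K → ∑ {M ℕ.* K} (λ B → χ (cotransversal M {K} B)) ≡ K ℕ.^ M
∑-cotransversal zero    K = ∑-[] _
∑-cotransversal (suc M) K = begin
  ∑ (λ B → χ (cotransversal (suc M) {K} B))
    ≡⟨ ∑-++ K (λ B → χ (cotransversal (suc M) {K} B)) ⟩
  ∑ {K} (λ X → ∑ {M ℕ.* K} λ Y → χ (cotransversal (suc M) {K} (X ++ Y)))
    ≡⟨ ∑-cong (λ X → ∑-cong (λ Y → cong₂ (λ X Y → χ (does (miss X ℕ.≟ 1) ∧ cotransversal M {K} Y))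
         (take-++ X Y) (drop-++ X Y))) ⟩
  ∑ {K} (λ X → ∑ {M ℕ.* K} λ Y → χ (does (miss X ℕ.≟ 1) ∧ cotransversal M {K} Y))
    ≡⟨ ∑-cong (λ X → trans (∑-cong (λ Y → χ-∧ (does (miss X ℕ.≟ 1)) (cotransversal M {K} Y)))
                           (∑-* (χ (does (miss X ℕ.≟ 1))) (λ Y → χ (cotransversal M {K} Y)))) ⟩
  ∑ {K} (λ X → χ (does (miss X ℕ.≟ 1)) ℕ.* ∑ {M ℕ.* K} λ Y → χ (cotransversal M {K} Y))
    ≡⟨ ∑-cong (λ X → trans (cong (χ (does (miss X ℕ.≟ 1)) ℕ.*_) (∑-cotransversal M K))
                           (ℕₚ.*-comm (χ (does (miss X ℕ.≟ 1))) (K ℕ.^ M))) ⟩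
  ∑ {K} (λ X → K ℕ.^ M ℕ.* χ (does (miss X ℕ.≟ 1)))
    ≡⟨ ∑-* (K ℕ.^ M) (λ X → χ (does (miss X ℕ.≟ 1))) ⟩
  K ℕ.^ M ℕ.* ∑ {K} (λ X → χ (does (miss X ℕ.≟ 1)))
    ≡⟨ cong (K ℕ.^ M ℕ.*_) (∑-miss≡1 K) ⟩
  K ℕ.^ M ℕ.* K
    ≡⟨ ℕₚ.*-comm (K ℕ.^ M) K ⟩
  K ℕ.^ suc M ∎
  where
  open ≡-Reasoning
  χ-∧ : ∀ b c → χ (b ∧ c) ≡ χ b ℕ.* χ c
  χ-∧ true  c = sym (ℕₚ.*-identityˡ (χ c))
  χ-∧ false c = refl

does⇒ : ∀ {P : Set} (P? : Dec P) → does P? ≡ true → P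
does⇒ (yes p) _ = p

cotransversal-suc : ∀ M {K} (B : Subset (suc M ℕ.* K)) → cotransversal (suc M) {K} B ≡ true →
                    miss (take K B) ≡ 1 × cotransversal M (drop K B) ≡ true
cotransversal-suc M {K} B ct =
  does⇒ (miss (take K B) ℕ.≟ 1) (Boolₚ.∧-conicalˡ _ _ ct) , Boolₚ.∧-conicalʳ _ _ ct

miss-cotransversal : ∀ M {K} (B : Subset (M ℕ.* K)) → cotransversal M {K} B ≡ true → miss B ≡ M
miss-cotransversal zero        []  ct = refl
miss-cotransversal (suc M) {K} B ct =
  let one , ct′ = cotransversal-suc M {K} B ct in
  trans (cong miss (sym (Vecₚ.take++drop≡id K B)))
    (trans (miss-++ (take K B) (drop K B))
      (cong₂ ℕ._+_ one (miss-cotransversal M {K} (drop K B) ct′)))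

miss-blowup-∷ : ∀ {M} K x (a : Subset M) (X : Subset K) (Y : Subset (M ℕ.* K)) →
  miss (blowup K (x ∷ a) ∪ (X ++ Y)) ≡ miss (Vec.replicate K x ∪ X) ℕ.+ miss (blowup K a ∪ Y)
miss-blowup-∷ K x a X Y = trans
  (cong miss (Vecₚ.zipWith-++ _∨_ (Vec.replicate K x) (blowup K a) X Y))
  (miss-++ (Vec.replicate K x ∪ X) (blowup K a ∪ Y))

-- Block `t` of the blow-up is full, so it supplies the point that `B` misses there; in every other
-- block the union misses at most the one point that `B` misses.
miss-blowup-∪ : ∀ M K (a : Subset M) (B : Subset (M ℕ.* K)) → cotransversal M {K} B ≡ true →
                ∀ {t} → t ∈ a → miss (blowup K a ∪ B) ℕ.< M
miss-blowup-∪ (suc M) K (x ∷ a) B ct t∈ = begin-strict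
  miss (blowup K (x ∷ a) ∪ B)
    ≡⟨ cong (λ B → miss (blowup K (x ∷ a) ∪ B)) (Vecₚ.take++drop≡id K B) ⟨
  miss (blowup K (x ∷ a) ∪ (X ++ Y))
    ≡⟨ miss-blowup-∷ K x a X Y ⟩
  miss (Vec.replicate K x ∪ X) ℕ.+ miss (blowup K a ∪ Y)
    <⟨ block t∈ ⟩
  suc M ∎
  where
  open ℕₚ.≤-Reasoning
  X : Subset K
  X = take K B
  Y : Subset (M ℕ.* K)
  Y = drop K B
  block : ∀ {t} → t ∈ x ∷ a → miss (Vec.replicate K x ∪ X) ℕ.+ miss (blowup K a ∪ Y) ℕ.< suc M
  block Vec.here = ℕₚ.≤-<-trans
    (ℕₚ.≤-reflexive (cong (ℕ._+ miss (blowup K a ∪ Y)) (miss-⊤∪ X)))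
    (ℕ.s≤s (ℕₚ.≤-trans (miss-∪ʳ (blowup K a) Y)
      (ℕₚ.≤-reflexive (miss-cotransversal M {K} Y (proj₂ (cotransversal-suc M {K} B ct))))))
  block (Vec.there t∈a) = ℕₚ.+-mono-≤-<
    (ℕₚ.≤-trans (miss-∪ʳ (Vec.replicate K x) X)
      (ℕₚ.≤-reflexive (proj₁ (cotransversal-suc M {K} B ct))))
    (miss-blowup-∪ M K a Y (proj₂ (cotransversal-suc M {K} B ct)) t∈a)

-- Tokens contained in a set, and the weight at a point.

trace : ∀ {M n} → (Fin M → Fin n) → Subset n → Subset M
trace q A = Vec.tabulate (lookup A ∘ q)

trace-∪ : ∀ {M n} (q : Fin M → Fin n) A B → trace q (A ∪ B) ≡ trace q A ∪ trace q B
trace-∪ q A B = trans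
  (Vecₚ.tabulate-cong λ t → trans (Vecₚ.lookup-zipWith _∨_ (q t) A B)
    (trans (cong₂ _∨_ (sym (Vecₚ.lookup∘tabulate (lookup A ∘ q) t)) (sym (Vecₚ.lookup∘tabulate (lookup B ∘ q) t)))
      (sym (Vecₚ.lookup-zipWith _∨_ t (trace q A) (trace q B)))))
  (Vecₚ.tabulate∘lookup (trace q A ∪ trace q B))

-- The numerator of the frequency of `x`, for natural weights.
weightOf : ∀ {n} → (Subset n → ℕ) → Fin n → ℕ
weightOf w x = ∑ λ A → χ (lookup A x) ℕ.* w A

χ-yes : ∀ {P : Set} (P? : Dec P) → P → χ (does P?) ≡ 1
χ-yes P? p = cong χ (dec-true P? p)

χ≤1 : ∀ b → χ b ℕ.≤ 1
χ≤1 true  = ℕₚ.≤-refl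
χ≤1 false = ℕ.z≤n

χ*≤ : ∀ b k → χ b ℕ.* k ℕ.≤ k
χ*≤ b k = ℕₚ.≤-trans (ℕₚ.*-monoˡ-≤ k (χ≤1 b)) (ℕₚ.≤-reflexive (ℕₚ.*-identityˡ k))

trace-⁅⁆ : ∀ {M n} (q : Fin M → Fin n) i → i ∈ trace q ⁅ q i ⁆
trace-⁅⁆ q i = Vecₚ.lookup⇒[]= i (trace q ⁅ q i ⁆)
  (trans (Vecₚ.lookup∘tabulate (lookup ⁅ q i ⁆ ∘ q) i) (Vecₚ.[]=⇒lookup (Subₚ.x∈⁅x⁆ (q i))))

-- Adding one layer of new points and sets.

module AddLayer {n M : ℕ} (K : ℕ) (w : Subset n → ℕ) (q : Fin M → Fin n) (i : Fin M) (U : ℕ)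
  (w-∪     : ∀ A B → w A ℕ.⊓ w B ℕ.≤ w (A ∪ B))
  (support : ∀ A → w A ≢ 0 → Nonempty (trace q A))
  where

  -- The number of generic new sets. Old weights are scaled by it, so that an old unit `U` becomes
  -- `G * U`, which is also what the generic new sets receive together at `U` apiece.
  G : ℕ
  G = K ℕ.^ M

  lift : Subset n → Subset (M ℕ.* K)
  lift A = blowup K (trace q A)

  lift-∪ : ∀ A B → lift (A ∪ B) ≡ lift A ∪ lift B
  lift-∪ A B = trans (cong (blowup K) (trace-∪ q A B)) (blowup-∪ K (trace q A) (trace q B))

  Cotransversal : Subset (M ℕ.* K) → Set
  Cotransversal B = cotransversal M {K} B ≡ true

  -- The sets A ++ B of positive new weight: enlarged old sets, sets missing few new
  -- points, and the generic new sets.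
  Present : Subset n → Subset (M ℕ.* K) → Set
  Present A B = (Nonempty (trace q A) × (B ≡ lift A ⊎ miss B ℕ.< M))
              ⊎ (A ≡ ⁅ q i ⁆ × Cotransversal B)

  present? : ∀ A B → Dec (Present A B)
  present? A B = (Subₚ.nonempty? (trace q A) ×-dec ((B ≟ lift A) ⊎-dec (miss B ℕ.<? M)))
           ⊎-dec ((A ≟ ⁅ q i ⁆) ×-dec (cotransversal M {K} B ≟ᵇ true))

  nonempty : ∀ {A B} → Present A B → Nonempty (trace q A)
  nonempty (inj₁ (ne , _))   = ne
  nonempty (inj₂ (refl , _)) = i , trace-⁅⁆ q i

  nonempty-∪ : ∀ A A′ → Nonempty (trace q A) → Nonempty (trace q (A ∪ A′))
  nonempty-∪ A A′ (t , t∈) = t , subst (t ∈_) (sym (trace-∪ q A A′)) (Subₚ.x∈p∪q⁺ (inj₁ t∈))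

  lift-cotransversal : ∀ A B → Nonempty (trace q A) → Cotransversal B → miss (lift A ∪ B) ℕ.< M
  lift-cotransversal A B (t , t∈) ct = miss-blowup-∪ M K (trace q A) B ct t∈

  -- Missing fewer than `M` new points survives any union, and enlarged sets are closed under union
  -- by `lift-∪`. An enlarged set fills a whole block, hence also the point that a generic new set
  -- misses there. For two generic new sets, either the union misses fewer than `M` points or it
  -- equals the first of them.
  present-∪ : ∀ A B A′ B′ → Present A B → Present A′ B′ → Present (A ∪ A′) (B ∪ B′)
  present-∪ A B A′ B′ p p′ = go p p′
    where
    few : miss (B ∪ B′) ℕ.< M → Present (A ∪ A′) (B ∪ B′)
    few lt = inj₁ (nonempty-∪ A A′ (nonempty p) , inj₂ lt)
    go : Present A B → Present A′ B′ → Present (A ∪ A′) (B ∪ B′)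
    go (inj₁ (_ , inj₂ lt)) _ = few (ℕₚ.≤-<-trans (miss-∪ˡ B B′) lt)
    go _ (inj₁ (_ , inj₂ lt)) = few (ℕₚ.≤-<-trans (miss-∪ʳ B B′) lt)
    go (inj₁ (ne , inj₁ refl)) (inj₁ (_ , inj₁ refl)) =
      inj₁ (nonempty-∪ A A′ ne , inj₁ (sym (lift-∪ A A′)))
    go (inj₁ (ne , inj₁ refl)) (inj₂ (_ , ct)) = few (lift-cotransversal A B′ ne ct)
    go (inj₂ (_ , ct)) (inj₁ (ne , inj₁ refl)) =
      few (subst (λ C → miss C ℕ.< M) (Subₚ.∪-comm (lift A′) B) (lift-cotransversal A′ B ne ct))
    go (inj₂ (refl , ct)) (inj₂ (refl , ct′)) with ℕₚ.m≤n⇒m<n∨m≡n (miss-∪ˡ B B′)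
    ... | inj₁ lt = few (subst (miss (B ∪ B′) ℕ.<_) (miss-cotransversal M {K} B ct) lt)
    ... | inj₂ eq = inj₂ (Subₚ.∪-idem ⁅ q i ⁆ , subst Cotransversal (sym (miss-∪-≡ B B′ eq)) ct)

  old : Subset n → Subset (M ℕ.* K) → ℕ
  old A B = χ (does (B ≟ lift A)) ℕ.* (G ℕ.* w A)

  old-∪ : ∀ A B A′ B′ → old A B ℕ.⊓ old A′ B′ ℕ.≤ old (A ∪ A′) (B ∪ B′)
  old-∪ A B A′ B′ = go (B ≟ lift A) (B′ ≟ lift A′)
    where
    open ℕₚ.≤-Reasoning
    go : (d : Dec (B ≡ lift A)) (d′ : Dec (B′ ≡ lift A′)) →
         (χ (does d) ℕ.* (G ℕ.* w A)) ℕ.⊓ (χ (does d′) ℕ.* (G ℕ.* w A′)) ℕ.≤ old (A ∪ A′) (B ∪ B′)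
    go (no _)     _          = ℕ.z≤n
    go _          (no _)     = ℕₚ.≤-trans (ℕₚ.m⊓n≤n _ 0) ℕ.z≤n
    go (yes refl) (yes refl) = begin
      (1 ℕ.* (G ℕ.* w A)) ℕ.⊓ (1 ℕ.* (G ℕ.* w A′))
        ≡⟨ cong₂ ℕ._⊓_ (ℕₚ.*-identityˡ (G ℕ.* w A)) (ℕₚ.*-identityˡ (G ℕ.* w A′)) ⟩
      (G ℕ.* w A) ℕ.⊓ (G ℕ.* w A′)
        ≡⟨ ℕₚ.*-distribˡ-⊓ G (w A) (w A′) ⟨
      G ℕ.* (w A ℕ.⊓ w A′)
        ≤⟨ ℕₚ.*-monoʳ-≤ G (w-∪ A A′) ⟩
      G ℕ.* w (A ∪ A′)
        ≡⟨ ℕₚ.*-identityˡ _ ⟨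
      1 ℕ.* (G ℕ.* w (A ∪ A′))
        ≡⟨ cong (ℕ._* (G ℕ.* w (A ∪ A′)))
             (χ-yes (lift A ∪ lift A′ ≟ lift (A ∪ A′)) (sym (lift-∪ A A′))) ⟨
      old (A ∪ A′) (lift A ∪ lift A′) ∎

  W : Subset n → Subset (M ℕ.* K) → ℕ
  W A B = χ (does (present? A B)) ℕ.* (U ℕ.+ old A B)

  -- Absent sets have weight 0, and present sets are closed under union. Adding the constant `U`
  -- commutes with the minimum, which leaves `old-∪`.
  W-∪ : ∀ A B A′ B′ → W A B ℕ.⊓ W A′ B′ ℕ.≤ W (A ∪ A′) (B ∪ B′)
  W-∪ A B A′ B′ = go (present? A B) (present? A′ B′)
    where
    open ℕₚ.≤-Reasoning
    go : (d : Dec (Present A B)) (d′ : Dec (Present A′ B′)) →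
         (χ (does d) ℕ.* (U ℕ.+ old A B)) ℕ.⊓ (χ (does d′) ℕ.* (U ℕ.+ old A′ B′)) ℕ.≤
         W (A ∪ A′) (B ∪ B′)
    go (no _)  _        = ℕ.z≤n
    go _       (no _)   = ℕₚ.≤-trans (ℕₚ.m⊓n≤n _ 0) ℕ.z≤n
    go (yes p) (yes p′) = begin
      (1 ℕ.* (U ℕ.+ old A B)) ℕ.⊓ (1 ℕ.* (U ℕ.+ old A′ B′))
        ≡⟨ cong₂ ℕ._⊓_ (ℕₚ.*-identityˡ (U ℕ.+ old A B)) (ℕₚ.*-identityˡ (U ℕ.+ old A′ B′)) ⟩
      (U ℕ.+ old A B) ℕ.⊓ (U ℕ.+ old A′ B′)
        ≡⟨ ℕₚ.+-distribˡ-⊓ U (old A B) (old A′ B′) ⟨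
      U ℕ.+ old A B ℕ.⊓ old A′ B′
        ≤⟨ ℕₚ.+-monoʳ-≤ U (old-∪ A B A′ B′) ⟩
      U ℕ.+ old (A ∪ A′) (B ∪ B′)
        ≡⟨ ℕₚ.*-identityˡ _ ⟨
      1 ℕ.* (U ℕ.+ old (A ∪ A′) (B ∪ B′))
        ≡⟨ cong (ℕ._* (U ℕ.+ old (A ∪ A′) (B ∪ B′)))
             (χ-yes (present? (A ∪ A′) (B ∪ B′)) (present-∪ A B A′ B′ p p′)) ⟨
      W (A ∪ A′) (B ∪ B′) ∎

  W-support : ∀ A B → W A B ≢ 0 → Nonempty (trace q A)
  W-support A B = go (present? A B)
    where
    go : (d : Dec (Present A B)) → χ (does d) ℕ.* (U ℕ.+ old A B) ≢ 0 → Nonempty (trace q A)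
    go (yes p) _   = nonempty p
    go (no _)  0≢0 = ⊥-elim (0≢0 refl)

  -- Indicators of the clauses of `Present`: `α` for enlarged old sets, `β` for sets missing few new
  -- points, the product of `γ` and `κ` for generic new sets.
  α : Subset n → Subset (M ℕ.* K) → ℕ
  α A B = χ (does (B ≟ lift A))

  β κ : Subset (M ℕ.* K) → ℕ
  β B = χ (does (miss B ℕ.<? M))
  κ B = χ (cotransversal M {K} B)

  γ : Subset n → ℕ
  γ A = χ (does (A ≟ ⁅ q i ⁆))

  -- The `U` of a present set is charged to an indicator that covers it. The selection bit `b` is
  -- kept for old weight and for generic new sets; the other sets are charged whether selected or
  -- not, since their total is negligible.
  W-upper : ∀ b A B → χ b ℕ.* W A B ℕ.≤
    α A B ℕ.* (χ b ℕ.* (G ℕ.* w A)) ℕ.+ U ℕ.* (α A B ℕ.+ β B) ℕ.+ γ A ℕ.* (χ b ℕ.* (κ B ℕ.* U))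
  W-upper false A B = ℕ.z≤n
  W-upper true  A B = go (present? A B)
    where
    open ℕₚ.≤-Reasoning
    covered : Present A B → 1 ℕ.≤ α A B ℕ.+ β B ℕ.+ γ A ℕ.* κ B
    covered (inj₁ (_ , inj₁ eq)) = ℕₚ.≤-trans (ℕₚ.≤-reflexive (sym (χ-yes (B ≟ lift A) eq)))
      (ℕₚ.≤-trans (ℕₚ.m≤m+n (α A B) (β B)) (ℕₚ.m≤m+n (α A B ℕ.+ β B) (γ A ℕ.* κ B)))
    covered (inj₁ (_ , inj₂ lt)) = ℕₚ.≤-trans (ℕₚ.≤-reflexive (sym (χ-yes (miss B ℕ.<? M) lt)))
      (ℕₚ.≤-trans (ℕₚ.m≤n+m (β B) (α A B)) (ℕₚ.m≤m+n (α A B ℕ.+ β B) (γ A ℕ.* κ B)))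
    covered (inj₂ (eq , ct)) = ℕₚ.≤-trans
      (ℕₚ.≤-reflexive (sym (cong₂ ℕ._*_ (χ-yes (A ≟ ⁅ q i ⁆) eq) (cong χ ct))))
      (ℕₚ.m≤n+m (γ A ℕ.* κ B) (α A B ℕ.+ β B))
    lhs : ∀ U a g → 1 ℕ.* (1 ℕ.* (U ℕ.+ a ℕ.* g)) ≡ a ℕ.* g ℕ.+ U ℕ.* 1
    lhs = solve-∀
    rhs : ∀ U a b c k g → a ℕ.* g ℕ.+ U ℕ.* (a ℕ.+ b ℕ.+ c ℕ.* k) ≡
          a ℕ.* (1 ℕ.* g) ℕ.+ U ℕ.* (a ℕ.+ b) ℕ.+ c ℕ.* (1 ℕ.* (k ℕ.* U))
    rhs = solve-∀
    go : (d : Dec (Present A B)) → 1 ℕ.* (χ (does d) ℕ.* (U ℕ.+ old A B)) ℕ.≤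
      α A B ℕ.* (1 ℕ.* (G ℕ.* w A)) ℕ.+ U ℕ.* (α A B ℕ.+ β B) ℕ.+ γ A ℕ.* (1 ℕ.* (κ B ℕ.* U))
    go (no _)  = ℕ.z≤n
    go (yes p) = begin
      1 ℕ.* (1 ℕ.* (U ℕ.+ α A B ℕ.* (G ℕ.* w A)))
        ≡⟨ lhs U (α A B) (G ℕ.* w A) ⟩
      α A B ℕ.* (G ℕ.* w A) ℕ.+ U ℕ.* 1
        ≤⟨ ℕₚ.+-monoʳ-≤ (α A B ℕ.* (G ℕ.* w A)) (ℕₚ.*-monoʳ-≤ U (covered p)) ⟩
      α A B ℕ.* (G ℕ.* w A) ℕ.+ U ℕ.* (α A B ℕ.+ β B ℕ.+ γ A ℕ.* κ B)
        ≡⟨ rhs U (α A B) (β B) (γ A) (κ B) (G ℕ.* w A) ⟩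
      α A B ℕ.* (1 ℕ.* (G ℕ.* w A)) ℕ.+ U ℕ.* (α A B ℕ.+ β B) ℕ.+ γ A ℕ.* (1 ℕ.* (κ B ℕ.* U)) ∎

  -- No old weight is lost: positive weight forces a nonempty trace by `support`, so the enlarged
  -- set is present. Generic new sets are present by definition.
  W-lower : ∀ A B → old A B ℕ.+ γ A ℕ.* (κ B ℕ.* U) ℕ.≤ W A B
  W-lower A B = go (present? A B)
    where
    open ℕₚ.≤-Reasoning
    old≡0 : ¬ Present A B → (d : Dec (B ≡ lift A)) → χ (does d) ℕ.* (G ℕ.* w A) ≡ 0
    old≡0 ¬p (no _)   = refl
    old≡0 ¬p (yes eq) with w A ℕ.≟ 0
    ... | yes wA≡0 = trans (ℕₚ.*-identityˡ (G ℕ.* w A)) (trans (cong (G ℕ.*_) wA≡0) (ℕₚ.*-zeroʳ G))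
    ... | no  wA≢0 = contradiction (inj₁ (support A wA≢0 , inj₁ eq)) ¬p
    new≡0 : ¬ Present A B → (d : Dec (A ≡ ⁅ q i ⁆)) → ∀ b → cotransversal M {K} B ≡ b →
            χ (does d) ℕ.* (χ b ℕ.* U) ≡ 0
    new≡0 ¬p (no _)   _     _  = refl
    new≡0 ¬p (yes _)  false _  = refl
    new≡0 ¬p (yes eq) true  ct = contradiction (inj₂ (eq , ct)) ¬p
    go : (d : Dec (Present A B)) →
         old A B ℕ.+ γ A ℕ.* (κ B ℕ.* U) ℕ.≤ χ (does d) ℕ.* (U ℕ.+ old A B)
    go (no ¬p) = ℕₚ.≤-reflexive
      (cong₂ ℕ._+_ (old≡0 ¬p (B ≟ lift A)) (new≡0 ¬p (A ≟ ⁅ q i ⁆) (cotransversal M {K} B) refl))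
    go (yes _) = begin
      old A B ℕ.+ γ A ℕ.* (κ B ℕ.* U)
        ≤⟨ ℕₚ.+-monoʳ-≤ (old A B) (ℕₚ.≤-trans (χ*≤ (does (A ≟ ⁅ q i ⁆)) (κ B ℕ.* U))
                                               (χ*≤ (cotransversal M {K} B) U)) ⟩
      old A B ℕ.+ U
        ≡⟨ ℕₚ.+-comm (old A B) U ⟩
      U ℕ.+ old A B
        ≡⟨ ℕₚ.*-identityˡ (U ℕ.+ old A B) ⟨
      1 ℕ.* (U ℕ.+ old A B) ∎

  -- Bounds the number of present sets that are not generic new sets.
  excess : ℕ
  excess = 2 ℕ.^ n ℕ.* (1 ℕ.+ ∑ β)

  ∑κ : ∑ κ ≡ G
  ∑κ = ∑-cotransversal M K

  -- The selector `s` will be membership of a fixed point. Old weight sits only at `B = lift A` and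
  -- generic new weight only at the singleton of the token, so both double sums collapse by
  -- `∑-pick`.
  ∑W-upper : (s : Subset n → Subset (M ℕ.* K) → Bool) →
    ∑ (λ A → ∑ λ B → χ (s A B) ℕ.* W A B) ℕ.≤
    G ℕ.* ∑ (λ A → χ (s A (lift A)) ℕ.* w A) ℕ.+ U ℕ.* excess ℕ.+
      ∑ (λ B → χ (s ⁅ q i ⁆ B) ℕ.* (κ B ℕ.* U))
  ∑W-upper s = begin
    ∑ (λ A → ∑ λ B → χ (s A B) ℕ.* W A B)
      ≤⟨ ∑-mono (λ A → ∑-mono λ B → W-upper (s A B) A B) ⟩
    ∑ (λ A → ∑ λ B → f A B ℕ.+ g A B ℕ.+ h A B)
      ≡⟨ ∑-cong inner ⟩
    ∑ (λ A → G ℕ.* f′ A ℕ.+ U ℕ.* (1 ℕ.+ ∑ β) ℕ.+ γ A ℕ.* h′ A)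
      ≡⟨ ∑-+ (λ A → G ℕ.* f′ A ℕ.+ U ℕ.* (1 ℕ.+ ∑ β)) (λ A → γ A ℕ.* h′ A) ⟩
    ∑ (λ A → G ℕ.* f′ A ℕ.+ U ℕ.* (1 ℕ.+ ∑ β)) ℕ.+ ∑ (λ A → γ A ℕ.* h′ A)
      ≡⟨ cong₂ ℕ._+_ (∑-+ (λ A → G ℕ.* f′ A) (λ _ → U ℕ.* (1 ℕ.+ ∑ β))) (∑-pick ⁅ q i ⁆ h′) ⟩
    ∑ (λ A → G ℕ.* f′ A) ℕ.+ ∑ {n} (λ _ → U ℕ.* (1 ℕ.+ ∑ β)) ℕ.+ h′ ⁅ q i ⁆
      ≡⟨ cong (ℕ._+ h′ ⁅ q i ⁆) (cong₂ ℕ._+_ (∑-* G f′)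
           (trans (∑-const n (U ℕ.* (1 ℕ.+ ∑ β))) (rearrange (2 ℕ.^ n) U (1 ℕ.+ ∑ β)))) ⟩
    G ℕ.* ∑ f′ ℕ.+ U ℕ.* excess ℕ.+ h′ ⁅ q i ⁆ ∎
    where
    open ℕₚ.≤-Reasoning
    f g h : Subset n → Subset (M ℕ.* K) → ℕ
    f A B = α A B ℕ.* (χ (s A B) ℕ.* (G ℕ.* w A))
    g A B = U ℕ.* (α A B ℕ.+ β B)
    h A B = γ A ℕ.* (χ (s A B) ℕ.* (κ B ℕ.* U))
    f′ h′ : Subset n → ℕ
    f′ A = χ (s A (lift A)) ℕ.* w A
    h′ A = ∑ λ B → χ (s A B) ℕ.* (κ B ℕ.* U)
    rearrange : ∀ a b c → a ℕ.* (b ℕ.* c) ≡ b ℕ.* (a ℕ.* c)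
    rearrange = solve-∀
    inner : ∀ A → ∑ (λ B → f A B ℕ.+ g A B ℕ.+ h A B) ≡
                  G ℕ.* f′ A ℕ.+ U ℕ.* (1 ℕ.+ ∑ β) ℕ.+ γ A ℕ.* h′ A
    inner A = trans (∑-+ (λ B → f A B ℕ.+ g A B) (h A)) (cong₂ ℕ._+_
      (trans (∑-+ (f A) (g A)) (cong₂ ℕ._+_
        (trans (∑-pick (lift A) (λ B → χ (s A B) ℕ.* (G ℕ.* w A)))
               (rearrange (χ (s A (lift A))) G (w A)))
        (trans (∑-* U (λ B → α A B ℕ.+ β B))
               (cong (U ℕ.*_) (trans (∑-+ (α A) β) (cong (ℕ._+ ∑ β) (∑-χ≟ (lift A))))))))
      (∑-* (γ A) (λ B → χ (s A B) ℕ.* (κ B ℕ.* U))))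

  ∑κU : ∑ (λ B → κ B ℕ.* U) ≡ G ℕ.* U
  ∑κU = trans (∑-cong λ B → ℕₚ.*-comm (κ B) U)
    (trans (∑-* U κ) (trans (cong (U ℕ.*_) ∑κ) (ℕₚ.*-comm U G)))

  ∑W-lower : G ℕ.* ∑ w ℕ.+ G ℕ.* U ℕ.≤ ∑ (λ A → ∑ (W A))
  ∑W-lower = begin
    G ℕ.* ∑ w ℕ.+ G ℕ.* U
      ≡⟨ cong₂ ℕ._+_ (∑-* G w) (trans (∑-pick ⁅ q i ⁆ (λ _ → ∑ (λ B → κ B ℕ.* U))) ∑κU) ⟨
    ∑ (λ A → G ℕ.* w A) ℕ.+ ∑ (λ A → γ A ℕ.* ∑ (λ B → κ B ℕ.* U))
      ≡⟨ ∑-+ (λ A → G ℕ.* w A) (λ A → γ A ℕ.* ∑ (λ B → κ B ℕ.* U)) ⟨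
    ∑ (λ A → G ℕ.* w A ℕ.+ γ A ℕ.* ∑ (λ B → κ B ℕ.* U))
      ≡⟨ ∑-cong (λ A → cong₂ ℕ._+_ (∑-pick (lift A) (λ _ → G ℕ.* w A))
                                   (∑-* (γ A) (λ B → κ B ℕ.* U))) ⟨
    ∑ (λ A → ∑ (old A) ℕ.+ ∑ (λ B → γ A ℕ.* (κ B ℕ.* U)))
      ≡⟨ ∑-cong (λ A → ∑-+ (old A) (λ B → γ A ℕ.* (κ B ℕ.* U))) ⟨
    ∑ (λ A → ∑ (λ B → old A B ℕ.+ γ A ℕ.* (κ B ℕ.* U)))
      ≤⟨ ∑-mono (λ A → ∑-mono (W-lower A)) ⟩
    ∑ (λ A → ∑ (W A)) ∎
    where open ℕₚ.≤-Reasoning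

-- The invariant of the construction.

-- The state after i of the M rounds.  Each round adds one unit of weight, of which
-- at most a fraction 1/M goes to sets other than its generic new sets; multiplied by
-- M, this error is the summand i in the three upper bounds.
record Layered (M i : ℕ) : Set where
  field
    {n}     : ℕ
    w       : Subset n → ℕ
    q       : Fin M → Fin n
    q-inj   : ∀ {s t} → q s ≡ q t → s ≡ t
    unit    : ℕ
    unit>0  : 0 ℕ.< unit
    w-∪     : ∀ A B → w A ℕ.⊓ w B ℕ.≤ w (A ∪ B)
    support : ∀ A → w A ≢ 0 → Nonempty (trace q A)
    total≥  : i ℕ.* unit ℕ.≤ ∑ w
    fresh≤  : ∀ t → i ℕ.≤ toℕ t → M ℕ.* weightOf w (q t) ℕ.≤ i ℕ.* unit
    token≤  : ∀ t → M ℕ.* weightOf w (q t) ℕ.≤ (M ℕ.+ i) ℕ.* unit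
    all≤    : ∀ x → M ℕ.* weightOf w x ℕ.≤ (M ℕ.+ M ℕ.+ i) ℕ.* unit

start : ∀ M → Layered M 0
start M = record
  { w = λ _ → 0
  ; q = λ t → t
  ; q-inj = λ eq → eq
  ; unit = 1
  ; unit>0 = ℕ.s≤s ℕ.z≤n
  ; w-∪ = λ _ _ → ℕ.z≤n
  ; support = λ _ 0≢0 → ⊥-elim (0≢0 refl)
  ; total≥ = ℕ.z≤n
  ; fresh≤ = λ t _ → no-weight t
  ; token≤ = λ t → ℕₚ.≤-trans (no-weight t) ℕ.z≤n
  ; all≤ = λ t → ℕₚ.≤-trans (no-weight t) ℕ.z≤n
  }
  where
  no-weight : ∀ x → M ℕ.* weightOf (λ (_ : Subset M) → 0) x ℕ.≤ 0
  no-weight x = ℕₚ.≤-reflexive (trans (cong (M ℕ.*_)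
    (trans (∑-cong (λ A → ℕₚ.*-zeroʳ (χ (lookup A x)))) (∑-0 M))) (ℕₚ.*-zeroʳ M))

lookup-⁅⁆-≢ : ∀ {n} {x y : Fin n} → x ≢ y → lookup ⁅ y ⁆ x ≡ false
lookup-⁅⁆-≢ {x = x} {y} x≢y with lookup ⁅ y ⁆ x in eq
... | false = refl
... | true  = contradiction (Subₚ.x∈⁅y⁆⇒x≡y y (Vecₚ.lookup⇒[]= x ⁅ y ⁆ eq)) x≢y

-- Choice of the block size.

-- Chosen so that the count in few-missing-blocks, at most E·(MK + 1)^M′ with
-- E = M·(2^n·2), is at most E·((M + 1)K)^M′ = K·K^M′.
blocksize : ℕ → ℕ → ℕ
blocksize n M′ = suc M′ ℕ.* (2 ℕ.^ n ℕ.* 2) ℕ.* suc (suc M′) ℕ.^ M′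

blocksize>0 : ∀ n M′ → 0 ℕ.< blocksize n M′
blocksize>0 n M′ = ℕₚ.*-mono-≤ {1} {_} {1}
  (ℕₚ.*-mono-≤ {1} {suc M′} {1} (ℕ.s≤s ℕ.z≤n)
    (ℕₚ.*-mono-≤ {1} {_} {1} (ℕₚ.m^n>0 2 n) (ℕ.s≤s ℕ.z≤n)))
  (ℕₚ.m^n>0 (suc (suc M′)) M′)

^-distribʳ-* : ∀ o m n → (m ℕ.* n) ℕ.^ o ≡ m ℕ.^ o ℕ.* n ℕ.^ o
^-distribʳ-* zero    m n = refl
^-distribʳ-* (suc o) m n = trans (cong (m ℕ.* n ℕ.*_) (^-distribʳ-* o m n))
  (interchange m n (m ℕ.^ o) (n ℕ.^ o))
  where
  interchange : ∀ a b c d → (a ℕ.* b) ℕ.* (c ℕ.* d) ≡ (a ℕ.* c) ℕ.* (b ℕ.* d)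
  interchange = solve-∀

-- The number of exceptional sets grows in `K` only with degree `M′`, one less than the degree of
-- the number `K ^ M` of generic new sets.
few-missing-blocks : ∀ n M′ → let M = suc M′ ; K = blocksize n M′ in
  M ℕ.* (2 ℕ.^ n ℕ.* (1 ℕ.+ ∑ {M ℕ.* K} (λ B → χ (does (miss B ℕ.<? M))))) ℕ.≤ K ℕ.^ M
few-missing-blocks n M′ = begin
  M ℕ.* (2 ℕ.^ n ℕ.* (1 ℕ.+ ∑ (λ B → χ (does (miss B ℕ.<? M)))))
    -- The summand 1 is absorbed by `1 ≤ P`, which produces `P + P`.
    ≤⟨ ℕₚ.*-monoʳ-≤ M (ℕₚ.*-monoʳ-≤ (2 ℕ.^ n)
         (ℕₚ.+-mono-≤ (ℕₚ.m^n>0 (suc (M ℕ.* K)) M′) (few-missing (M ℕ.* K) M′))) ⟩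
  M ℕ.* (2 ℕ.^ n ℕ.* (P ℕ.+ P))
    ≡⟨ double M (2 ℕ.^ n) P ⟩
  E ℕ.* P
    -- Since `1 ≤ K`, the base `1 + M * K` is at most `K + M * K`.
    ≤⟨ ℕₚ.*-monoʳ-≤ E (ℕₚ.^-monoˡ-≤ M′ (ℕₚ.+-monoˡ-≤ (M ℕ.* K) (blocksize>0 n M′))) ⟩
  E ℕ.* (suc M ℕ.* K) ℕ.^ M′
    ≡⟨ cong (E ℕ.*_) (^-distribʳ-* M′ (suc M) K) ⟩
  E ℕ.* (suc M ℕ.^ M′ ℕ.* K ℕ.^ M′)
    ≡⟨ ℕₚ.*-assoc E (suc M ℕ.^ M′) (K ℕ.^ M′) ⟨
  K ℕ.^ M ∎
  where
  open ℕₚ.≤-Reasoning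
  M K P E : ℕ
  M = suc M′
  K = blocksize n M′
  P = suc (M ℕ.* K) ℕ.^ M′
  E = M ℕ.* (2 ℕ.^ n ℕ.* 2)
  double : ∀ m a p → m ℕ.* (a ℕ.* (p ℕ.+ p)) ≡ m ℕ.* (a ℕ.* 2) ℕ.* p
  double = solve-∀

-- One round of the construction.

module Round {M′ i : ℕ} (i<M : i ℕ.< suc M′) (L : Layered (suc M′) i) where

  open Layered L

  M K : ℕ
  M = suc M′
  K = blocksize n M′

  ι : Fin M
  ι = Fin.fromℕ< i<M

  ι≡i : toℕ ι ≡ i
  ι≡i = Finₚ.toℕ-fromℕ< i<M

  open AddLayer K w q ι unit w-∪ support

  w′ : Subset (n ℕ.+ M ℕ.* K) → ℕ
  w′ C = W (take n C) (drop n C)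

  q′ : Fin M → Fin (n ℕ.+ M ℕ.* K)
  q′ t = q t ↑ˡ (M ℕ.* K)

  w′-++ : ∀ A B → w′ (A ++ B) ≡ W A B
  w′-++ A B = cong₂ W (take-++ A B) (drop-++ A B)

  w′-∪ : ∀ C D → w′ C ℕ.⊓ w′ D ℕ.≤ w′ (C ∪ D)
  w′-∪ C D = ℕₚ.≤-trans (W-∪ (take n C) (drop n C) (take n D) (drop n D))
    (ℕₚ.≤-reflexive (sym (cong₂ W (Vecₚ.take-zipWith _∨_ C D) (Vecₚ.drop-zipWith {m = n} _∨_ C D))))

  trace′ : ∀ C → trace q′ C ≡ trace q (take n C)
  trace′ C = Vecₚ.tabulate-cong λ t → trans
    (cong (λ C → lookup C (q′ t)) (sym (Vecₚ.take++drop≡id n C)))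
    (Vecₚ.lookup-++ˡ (take n C) (drop n C) (q t))

  total′ : ∑ (λ A → ∑ (W A)) ≡ ∑ w′
  total′ = sym (trans (∑-++ n w′) (∑-cong λ A → ∑-cong (w′-++ A)))

  total′≥ : suc i ℕ.* (G ℕ.* unit) ℕ.≤ ∑ w′
  total′≥ = begin
    suc i ℕ.* (G ℕ.* unit)
      ≡⟨ rearrange i G unit ⟩
    G ℕ.* (i ℕ.* unit) ℕ.+ G ℕ.* unit
      ≤⟨ ℕₚ.+-monoˡ-≤ (G ℕ.* unit) (ℕₚ.*-monoʳ-≤ G total≥) ⟩
    G ℕ.* ∑ w ℕ.+ G ℕ.* unit
      ≤⟨ ∑W-lower ⟩
    ∑ (λ A → ∑ (W A))
      ≡⟨ total′ ⟩
    ∑ w′ ∎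
    where
    open ℕₚ.≤-Reasoning
    rearrange : ∀ i g u → suc i ℕ.* (g ℕ.* u) ≡ g ℕ.* (i ℕ.* u) ℕ.+ g ℕ.* u
    rearrange = solve-∀

  -- The weight at `x` due to enlarged old sets, before scaling by `G`, and to generic new sets.
  old-part new-part : Fin (n ℕ.+ M ℕ.* K) → ℕ
  old-part x = ∑ λ A → χ (lookup (A ++ lift A) x) ℕ.* w A
  new-part x = ∑ λ B → χ (lookup (⁅ q ι ⁆ ++ B) x) ℕ.* (κ B ℕ.* unit)

  -- In the uses below, `h` is 1 if `x` may be frequent in this round and 0 otherwise. The summand 1
  -- is the error of the round: the exceptional sets contribute at most `unit * excess`, and
  -- `M * excess` is at most `G` by `few-missing-blocks`.
  weight′≤ : ∀ x f h → M ℕ.* old-part x ℕ.≤ f ℕ.* unit → new-part x ℕ.≤ h ℕ.* (G ℕ.* unit) →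
             M ℕ.* weightOf w′ x ℕ.≤ (f ℕ.+ 1 ℕ.+ M ℕ.* h) ℕ.* (G ℕ.* unit)
  weight′≤ x f h old≤ new≤ = begin
    M ℕ.* weightOf w′ x
      ≡⟨ cong (M ℕ.*_) (trans (∑-++ n _)
           (∑-cong λ A → ∑-cong λ B → cong (χ (lookup (A ++ B) x) ℕ.*_) (w′-++ A B))) ⟩
    M ℕ.* ∑ (λ A → ∑ λ B → χ (lookup (A ++ B) x) ℕ.* W A B)
      ≤⟨ ℕₚ.*-monoʳ-≤ M (∑W-upper (λ A B → lookup (A ++ B) x)) ⟩
    M ℕ.* (G ℕ.* old-part x ℕ.+ unit ℕ.* excess ℕ.+ new-part x)
      ≡⟨ spread M G unit (old-part x) excess (new-part x) ⟩
    G ℕ.* (M ℕ.* old-part x) ℕ.+ unit ℕ.* (M ℕ.* excess) ℕ.+ M ℕ.* new-part x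
      ≤⟨ ℕₚ.+-mono-≤ (ℕₚ.+-mono-≤ (ℕₚ.*-monoʳ-≤ G old≤)
                                   (ℕₚ.*-monoʳ-≤ unit (few-missing-blocks n M′)))
                     (ℕₚ.*-monoʳ-≤ M new≤) ⟩
    G ℕ.* (f ℕ.* unit) ℕ.+ unit ℕ.* G ℕ.+ M ℕ.* (h ℕ.* (G ℕ.* unit))
      ≡⟨ gather M G unit f h ⟩
    (f ℕ.+ 1 ℕ.+ M ℕ.* h) ℕ.* (G ℕ.* unit) ∎
    where
    open ℕₚ.≤-Reasoning
    spread : ∀ m g u o e p → m ℕ.* (g ℕ.* o ℕ.+ u ℕ.* e ℕ.+ p) ≡
             g ℕ.* (m ℕ.* o) ℕ.+ u ℕ.* (m ℕ.* e) ℕ.+ m ℕ.* p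
    spread = solve-∀
    gather : ∀ m g u f h → g ℕ.* (f ℕ.* u) ℕ.+ u ℕ.* g ℕ.+ m ℕ.* (h ℕ.* (g ℕ.* u)) ≡
             (f ℕ.+ 1 ℕ.+ m ℕ.* h) ℕ.* (g ℕ.* u)
    gather = solve-∀

  new-part≤ : ∀ x → new-part x ℕ.≤ 1 ℕ.* (G ℕ.* unit)
  new-part≤ x = ℕₚ.≤-trans (∑-mono λ B → χ*≤ (lookup (⁅ q ι ⁆ ++ B) x) (κ B ℕ.* unit))
    (ℕₚ.≤-reflexive (trans ∑κU (sym (ℕₚ.*-identityˡ (G ℕ.* unit)))))

  new-part-≢ : ∀ y → y ≢ q ι → new-part (y ↑ˡ (M ℕ.* K)) ℕ.≤ 0 ℕ.* (G ℕ.* unit)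
  new-part-≢ y y≢ = ℕₚ.≤-reflexive (trans
    (∑-cong λ B → cong (λ b → χ b ℕ.* (κ B ℕ.* unit))
      (trans (Vecₚ.lookup-++ˡ ⁅ q ι ⁆ B y) (lookup-⁅⁆-≢ y≢)))
    (∑-0 (M ℕ.* K)))

  old-part-↑ˡ : ∀ y → weightOf w y ≡ old-part (y ↑ˡ (M ℕ.* K))
  old-part-↑ˡ y = ∑-cong λ A → cong (λ b → χ b ℕ.* w A) (sym (Vecₚ.lookup-++ˡ A (lift A) y))

  -- A new point in the block of a token lies in an enlarged set exactly when the token does, so it
  -- inherits the old weight of that token.
  old-part-↑ʳ : ∀ z → weightOf w (q (Fin.quotient {M} K z)) ≡ old-part (n ↑ʳ z)
  old-part-↑ʳ z = ∑-cong λ A → cong (λ b → χ b ℕ.* w A) (sym (trans (Vecₚ.lookup-++ʳ A (lift A) z)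
    (trans (lookup-blowup K (trace q A) z) (Vecₚ.lookup∘tabulate (lookup A ∘ q) _))))

  weaken : ∀ {a b c} → a ℕ.≤ b ℕ.* (G ℕ.* unit) → b ℕ.≤ c → a ℕ.≤ c ℕ.* (G ℕ.* unit)
  weaken a≤ b≤c = ℕₚ.≤-trans a≤ (ℕₚ.*-monoˡ-≤ (G ℕ.* unit) b≤c)

  weight′-≢ : ∀ f y → y ≢ q ι → M ℕ.* weightOf w y ℕ.≤ f ℕ.* unit →
              M ℕ.* weightOf w′ (y ↑ˡ (M ℕ.* K)) ℕ.≤ suc f ℕ.* (G ℕ.* unit)
  weight′-≢ f y y≢ le = weaken
    (weight′≤ (y ↑ˡ (M ℕ.* K)) f 0
      (subst (λ o → M ℕ.* o ℕ.≤ f ℕ.* unit) (old-part-↑ˡ y) le) (new-part-≢ y y≢))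
    (ℕₚ.≤-reflexive (simplify f M))
    where
    simplify : ∀ f m → f ℕ.+ 1 ℕ.+ m ℕ.* 0 ≡ suc f
    simplify = solve-∀

  q-≢ : ∀ {t} → t ≢ ι → q t ≢ q ι
  q-≢ t≢ι = t≢ι ∘ q-inj

  fresh′≤ : ∀ t → suc i ℕ.≤ toℕ t → M ℕ.* weightOf w′ (q′ t) ℕ.≤ suc i ℕ.* (G ℕ.* unit)
  fresh′≤ t i<t = weight′-≢ i (q t)
    (q-≢ λ t≡ι → ℕₚ.<-irrefl (sym (trans (cong toℕ t≡ι) ι≡i)) i<t)
    (fresh≤ t (ℕₚ.<⇒≤ i<t))

  token′≤ : ∀ t → M ℕ.* weightOf w′ (q′ t) ℕ.≤ (M ℕ.+ suc i) ℕ.* (G ℕ.* unit)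
  token′≤ t with t Finₚ.≟ ι
  ... | no t≢ι   = weaken (weight′-≢ (M ℕ.+ i) (q t) (q-≢ t≢ι) (token≤ t))
                     (ℕₚ.≤-reflexive (sym (ℕₚ.+-suc M i)))
  -- The token of the current round was still fresh, so only error terms precede the full unit that
  -- it gains now.
  ... | yes refl = weaken
    (weight′≤ (q′ ι) i 1
      (subst (λ o → M ℕ.* o ℕ.≤ i ℕ.* unit) (old-part-↑ˡ (q ι))
        (fresh≤ ι (ℕₚ.≤-reflexive (sym ι≡i))))
      (new-part≤ (q′ ι)))
    (ℕₚ.≤-reflexive (simplify i M))
    where
    simplify : ∀ i m → i ℕ.+ 1 ℕ.+ m ℕ.* 1 ≡ m ℕ.+ suc i
    simplify = solve-∀

  all′≤ : ∀ x → M ℕ.* weightOf w′ x ℕ.≤ (M ℕ.+ M ℕ.+ suc i) ℕ.* (G ℕ.* unit)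
  all′≤ x with Fin.splitAt n x in eq
  ... | inj₁ y rewrite sym (Finₚ.splitAt⁻¹-↑ˡ eq) with y Finₚ.≟ q ι
  ...   | no y≢    = weaken (weight′-≢ (M ℕ.+ M ℕ.+ i) y y≢ (all≤ y))
                     (ℕₚ.≤-reflexive (sym (ℕₚ.+-suc (M ℕ.+ M) i)))
  ...   | yes refl = weaken (token′≤ ι) (ℕₚ.+-monoˡ-≤ (suc i) (ℕₚ.m≤m+n M M))
  -- A new point starts from the weight of its token, where `token≤` allows one full unit, and gains
  -- at most one more in this round.
  all′≤ x | inj₂ z rewrite sym (Finₚ.splitAt⁻¹-↑ʳ {i = x} eq) = weaken
    (weight′≤ (n ↑ʳ z) (M ℕ.+ i) 1
      (subst (λ o → M ℕ.* o ℕ.≤ (M ℕ.+ i) ℕ.* unit) (old-part-↑ʳ z) (token≤ (Fin.quotient {M} K z)))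
      (new-part≤ (n ↑ʳ z)))
    (ℕₚ.≤-reflexive (simplify i M))
    where
    simplify : ∀ i m → m ℕ.+ i ℕ.+ 1 ℕ.+ m ℕ.* 1 ≡ m ℕ.+ m ℕ.+ suc i
    simplify = solve-∀

  next : Layered (suc M′) (suc i)
  next = record
    { w = w′
    ; q = q′
    ; q-inj = λ eq → q-inj (Finₚ.↑ˡ-injective (M ℕ.* K) _ _ eq)
    ; unit = G ℕ.* unit
    ; unit>0 = ℕₚ.*-mono-≤ {1} {_} {1} (ℕₚ.m^n>0 K {{ℕ.>-nonZero (blocksize>0 n M′)}} M) unit>0
    ; w-∪ = w′-∪
    ; support = λ C w≢0 → subst Nonempty (sym (trace′ C)) (W-support (take n C) (drop n C) w≢0)
    ; total≥ = total′≥
    ; fresh≤ = fresh′≤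
    ; token≤ = token′≤
    ; all≤ = all′≤
    }

layered : ∀ M′ i → i ℕ.≤ suc M′ → Layered (suc M′) i
layered M′ zero    _   = start (suc M′)
layered M′ (suc i) i<M = Round.next i<M (layered M′ i (ℕₚ.<⇒≤ i<M))

-- Passage from natural to real weights

toℚ : ℕ → ℚ
toℚ n = + n ℚ./ 1

-- Identities for `toℚ` are checked on unnormalised fractions, which avoids normalisation by the
-- gcd.
toℚᵘ-toℚ : ∀ n → ℚ.toℚᵘ (toℚ n) ℚᵘ.≃ ℚᵘ.mkℚᵘ (+ n) 0
toℚᵘ-toℚ n = ℚₚ.toℚᵘ-fromℚᵘ (ℚᵘ.mkℚᵘ (+ n) 0)

toℚ-+ : ∀ m n → toℚ (m ℕ.+ n) ≡ toℚ m ℚ.+ toℚ n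
toℚ-+ m n = ℚₚ.toℚᵘ-injective (begin-equality
  ℚ.toℚᵘ (toℚ (m ℕ.+ n))
    ≃⟨ toℚᵘ-toℚ (m ℕ.+ n) ⟩
  ℚᵘ.mkℚᵘ (+ (m ℕ.+ n)) 0
    ≃⟨ ℚᵘ.*≡* (numerators (+ m) (+ n)) ⟩
  ℚᵘ.mkℚᵘ (+ m) 0 ℚᵘ.+ ℚᵘ.mkℚᵘ (+ n) 0
    ≃⟨ ℚᵘₚ.+-cong (toℚᵘ-toℚ m) (toℚᵘ-toℚ n) ⟨
  ℚ.toℚᵘ (toℚ m) ℚᵘ.+ ℚ.toℚᵘ (toℚ n)
    ≃⟨ ℚₚ.toℚᵘ-homo-+ (toℚ m) (toℚ n) ⟨
  ℚ.toℚᵘ (toℚ m ℚ.+ toℚ n) ∎)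
  where
  open ℚᵘₚ.≤-Reasoning
  numerators : ∀ a b → (a ℤ.+ b) ℤ.* 1ℤ ≡ (a ℤ.* 1ℤ ℤ.+ b ℤ.* 1ℤ) ℤ.* 1ℤ
  numerators a b = cong (ℤ._* 1ℤ)
    (sym (cong₂ ℤ._+_ (ℤₚ.*-identityʳ a) (ℤₚ.*-identityʳ b)))

toℚ-* : ∀ m n → toℚ (m ℕ.* n) ≡ toℚ m ℚ.* toℚ n
toℚ-* zero    n = sym (ℚₚ.*-zeroˡ (toℚ n))
toℚ-* (suc m) n = begin
  toℚ (n ℕ.+ m ℕ.* n)              ≡⟨ toℚ-+ n (m ℕ.* n) ⟩
  toℚ n ℚ.+ toℚ (m ℕ.* n)          ≡⟨ cong₂ ℚ._+_ (sym (ℚₚ.*-identityˡ (toℚ n))) (toℚ-* m n) ⟩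
  1ℚ ℚ.* toℚ n ℚ.+ toℚ m ℚ.* toℚ n ≡⟨ ℚₚ.*-distribʳ-+ (toℚ n) 1ℚ (toℚ m) ⟨
  (1ℚ ℚ.+ toℚ m) ℚ.* toℚ n         ≡⟨ cong (ℚ._* toℚ n) (toℚ-+ 1 m) ⟨
  toℚ (suc m) ℚ.* toℚ n            ∎
  where open ≡-Reasoning

0≤toℚ : ∀ n → 0ℚ ℚ.≤ toℚ n
0≤toℚ n = ℚₚ.nonNegative⁻¹ (toℚ n) {{ℚₚ.normalize-nonNeg n 1}}

toℚ-mono-≤ : ∀ {m n} → m ℕ.≤ n → toℚ m ℚ.≤ toℚ n
toℚ-mono-≤ {m} {n} m≤n = begin
  toℚ m                       ≡⟨ ℚₚ.+-identityʳ (toℚ m) ⟨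
  toℚ m ℚ.+ 0ℚ                ≤⟨ ℚₚ.+-monoʳ-≤ (toℚ m) (0≤toℚ (n ℕ.∸ m)) ⟩
  toℚ m ℚ.+ toℚ (n ℕ.∸ m)     ≡⟨ toℚ-+ m (n ℕ.∸ m) ⟨
  toℚ (m ℕ.+ (n ℕ.∸ m))       ≡⟨ cong toℚ (ℕₚ.m+[n∸m]≡n m≤n) ⟩
  toℚ n                       ∎
  where open ℚₚ.≤-Reasoning

0<toℚ : ∀ {n} → 0 ℕ.< n → 0ℚ ℚ.< toℚ n
0<toℚ {suc n} _ = ℚₚ.positive⁻¹ (toℚ (suc n)) {{ℚₚ.normalize-pos (suc n) 1}}

1/m*m≡1 : ∀ m .{{_ : ℕ.NonZero m}} → (1ℤ ℚ./ m) ℚ.* toℚ m ≡ 1ℚ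
1/m*m≡1 (suc m) = ℚₚ.toℚᵘ-injective (begin-equality
  ℚ.toℚᵘ ((1ℤ ℚ./ suc m) ℚ.* toℚ (suc m))
    ≃⟨ ℚₚ.toℚᵘ-homo-* (1ℤ ℚ./ suc m) (toℚ (suc m)) ⟩
  ℚ.toℚᵘ (1ℤ ℚ./ suc m) ℚᵘ.* ℚ.toℚᵘ (toℚ (suc m))
    ≃⟨ ℚᵘₚ.*-cong (ℚₚ.toℚᵘ-fromℚᵘ (ℚᵘ.mkℚᵘ 1ℤ m)) (toℚᵘ-toℚ (suc m)) ⟩
  ℚᵘ.mkℚᵘ 1ℤ m ℚᵘ.* ℚᵘ.mkℚᵘ (+ suc m) 0
    ≃⟨ ℚᵘ.*≡* (trans (ℤₚ.*-identityʳ (1ℤ ℤ.* + suc m))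
         (cong (λ k → 1ℤ ℤ.* + k) (sym (ℕₚ.*-identityʳ (suc m))))) ⟩
  ℚ.toℚᵘ 1ℚ ∎)
  where
  open ℚᵘₚ.≤-Reasoning

-- Multiplied by `t`, the claim reads `c = (1/m)(mc) ≤ (1/m)t`.
fraction≤ : ∀ m .{{_ : ℕ.NonZero m}} {c t} → 0 ℕ.< t → m ℕ.* c ℕ.≤ t →
            toℚ c ℚ.* inv (toℚ t) ℚ.≤ 1ℤ ℚ./ m
fraction≤ m {c} {t} t>0 mc≤t = ℚₚ.*-cancelʳ-≤-pos (toℚ t) {{ℚ.positive (0<toℚ t>0)}} (begin
  toℚ c ℚ.* inv (toℚ t) ℚ.* toℚ t
    ≡⟨ ℚₚ.*-assoc (toℚ c) (inv (toℚ t)) (toℚ t) ⟩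
  toℚ c ℚ.* (inv (toℚ t) ℚ.* toℚ t)
    ≡⟨ cong (toℚ c ℚ.*_) (inv-inverse (toℚ t) (λ eq → ℚₚ.<⇒≢ (0<toℚ t>0) (sym eq))) ⟩
  toℚ c ℚ.* 1ℚ
    ≡⟨ ℚₚ.*-comm (toℚ c) 1ℚ ⟩
  1ℚ ℚ.* toℚ c
    ≡⟨ cong (ℚ._* toℚ c) (1/m*m≡1 m) ⟨
  (1ℤ ℚ./ m) ℚ.* toℚ m ℚ.* toℚ c
    ≡⟨ ℚₚ.*-assoc (1ℤ ℚ./ m) (toℚ m) (toℚ c) ⟩
  (1ℤ ℚ./ m) ℚ.* (toℚ m ℚ.* toℚ c)
    ≡⟨ cong ((1ℤ ℚ./ m) ℚ.*_) (toℚ-* m c) ⟨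
  (1ℤ ℚ./ m) ℚ.* toℚ (m ℕ.* c)
    ≤⟨ ℚₚ.*-monoˡ-≤-nonNeg (1ℤ ℚ./ m) {{ℚₚ.normalize-nonNeg 1 m}} (toℚ-mono-≤ mc≤t) ⟩
  (1ℤ ℚ./ m) ℚ.* toℚ t ∎)
  where open ℚₚ.≤-Reasoning

-- Real frequencies and their maximum.

pointwise-≤ : ∀ {x y} → (∀ k → seq x k ℚ.≤ seq y k) → x ≤ y
pointwise-≤ {x} {y} le ε ε>0 = 0 , λ k _ →
  subst (ℚ._≤ seq y k ℚ.+ ε) (ℚₚ.+-identityʳ (seq x k)) (ℚₚ.+-mono-≤ (le k) (ℚₚ.<⇒≤ ε>0))

⊔-bound : ∀ {n} (f : Fin (suc n) → ℝ) {b} k → (∀ x → seq (f x) k ℚ.≤ b) →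
          seq (Vec.foldr₁ _⊔_ (Vec.tabulate f)) k ℚ.≤ b
⊔-bound {zero}  f k f≤b = f≤b zero
⊔-bound {suc n} f k f≤b = ℚₚ.⊔-lub (f≤b zero) (⊔-bound (f ∘ suc) k (f≤b ∘ suc))

δ-bound : ∀ {n} (w : Subset n → ℝ) adm {b} →
          (∀ x k → seq (frequency w adm x) k ℚ.≤ b) → δ w adm ≤ fromℚ b
δ-bound {zero}  w adm       freq≤ = ⊥-elim (empty-ground adm)
δ-bound {suc n} w adm {b} freq≤ = pointwise-≤ {δ w adm} {fromℚ b}
  λ k → ⊔-bound (frequency w adm) k (λ x → freq≤ x k)

real : ∀ {n} → (Subset n → ℕ) → Subset n → ℝ
real w A = fromℚ (toℚ (w A))

seq-sum : ∀ {n} (w : Subset n → ℕ) as k →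
          seq (sum (List.map (real w) as)) k ≡ toℚ (sumℕ (List.map w as))
seq-sum w []       k = refl
seq-sum w (A ∷ as) k = trans (cong (toℚ (w A) ℚ.+_) (seq-sum w as k))
  (sym (toℚ-+ (w A) (sumℕ (List.map w as))))

sum-filter : ∀ {n} (w : Subset n → ℕ) x as →
             sumℕ (List.map w (List.filter (x Subₚ.∈?_) as)) ≡
             sumℕ (List.map (λ A → χ (lookup A x) ℕ.* w A) as)
sum-filter w x []       = refl
sum-filter w x (A ∷ as) with x Subₚ.∈? A
... | yes x∈A = cong₂ ℕ._+_
  (trans (sym (ℕₚ.*-identityˡ (w A))) (cong (λ b → χ b ℕ.* w A) (sym (Vecₚ.[]=⇒lookup x∈A))))
  (sum-filter w x as)
... | no  x∉A = cong₂ ℕ._+_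
  (cong (λ b → χ b ℕ.* w A) (sym (Boolₚ.¬-not λ eq → x∉A (Vecₚ.lookup⇒[]= x A eq))))
  (sum-filter w x as)

-- The weights are constant sequences and `recip` inverts termwise, so every term is the same
-- rational quotient.
seq-frequency : ∀ {n} (w : Subset n → ℕ) adm x k →
  seq (frequency (real w) adm x) k ≡ toℚ (weightOf w x) ℚ.* inv (toℚ (∑ w))
seq-frequency {n} w adm x k = cong₂ (λ c t → c ℚ.* inv t)
  (trans (seq-sum w (List.filter (x Subₚ.∈?_) (subsets n)) k)
    (cong toℚ (trans (sum-filter w x (subsets n)) (sym (∑-def (λ A → χ (lookup A x) ℕ.* w A))))))
  (trans (seq-sum w (subsets n) k) (cong toℚ (sym (∑-def w))))

real-admissible : ∀ {n} (w : Subset n → ℕ) → 0 ℕ.< ∑ w → w Sub.⊥ ≡ 0 →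
                  (∀ A B → w A ℕ.⊓ w B ℕ.≤ w (A ∪ B)) → Admissible (real w)
real-admissible w w>0 w∅≡0 w-∪ = record
  { nonneg  = λ A → pointwise-≤ {0ℝ} {real w A} λ _ → 0≤toℚ (w A)
  ; nonzero = let A , wA≢0 = ∑≢0 w (ℕₚ.>⇒≢ w>0) in
      A , inj₂ (toℚ (w A) , 0<toℚ (ℕₚ.n≢0⇒n>0 wA≢0) , 0 , λ _ _ →
        ℚₚ.≤-reflexive (ℚₚ.+-identityˡ (toℚ (w A))))
  ; empty   = λ ε ε>0 → 0 , λ _ _ →
      subst (λ c → ℚ.∣ toℚ c ℚ.- 0ℚ ∣ ℚ.≤ ε) (sym w∅≡0) (ℚₚ.<⇒≤ ε>0)
  ; union   = λ A B → pointwise-≤ {real w A ⊓ real w B} {real w (A ∪ B)} λ _ → ⊓-toℚ (w-∪ A B)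
  }
  where
  ⊓-toℚ : ∀ {a b c} → a ℕ.⊓ b ℕ.≤ c → toℚ a ℚ.⊓ toℚ b ℚ.≤ toℚ c
  ⊓-toℚ {a} {b} le with ℕₚ.⊓-sel a b
  ... | inj₁ eq = ℚₚ.≤-trans (ℚₚ.p⊓q≤p (toℚ a) (toℚ b)) (toℚ-mono-≤ (subst (ℕ._≤ _) eq le))
  ... | inj₂ eq = ℚₚ.≤-trans (ℚₚ.p⊓q≤q (toℚ a) (toℚ b)) (toℚ-mono-≤ (subst (ℕ._≤ _) eq le))

trace-∅ : ∀ {M n} (q : Fin M → Fin n) → ¬ Nonempty (trace q Sub.⊥)
trace-∅ q (t , t∈) with trans (sym (Vecₚ.[]=⇒lookup t∈))
  (trans (Vecₚ.lookup∘tabulate (lookup Sub.⊥ ∘ q) t) (Vecₚ.lookup-replicate (q t) outside))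
... | ()

-- The bound 1/m after all 3m rounds.

module _ (m : ℕ) .{{_ : ℕ.NonZero m}} (L : Layered (m ℕ.* 3) (m ℕ.* 3)) where

  open Layered L

  private instance
    m*3≢0 : ℕ.NonZero (m ℕ.* 3)
    m*3≢0 = m*n≢0 m 3

  total>0 : 0 ℕ.< ∑ w
  total>0 = ℕₚ.≤-trans (ℕₚ.*-mono-≤ (ℕ.>-nonZero⁻¹ (m ℕ.* 3)) unit>0) total≥

  -- With `i = M = 3m` the bound `all≤` becomes `M * weight ≤ 3M * unit`. Hence each point has
  -- weight at most three units, out of a total of at least `3m` units.
  rare : ∀ x → m ℕ.* weightOf w x ℕ.≤ ∑ w
  rare x = begin
    m ℕ.* weightOf w x      ≤⟨ ℕₚ.*-monoʳ-≤ m (ℕₚ.*-cancelˡ-≤ (m ℕ.* 3) weight≤) ⟩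
    m ℕ.* (3 ℕ.* unit)      ≡⟨ ℕₚ.*-assoc m 3 unit ⟨
    m ℕ.* 3 ℕ.* unit        ≤⟨ total≥ ⟩
    ∑ w                     ∎
    where
    open ℕₚ.≤-Reasoning
    triple : ∀ M u → (M ℕ.+ M ℕ.+ M) ℕ.* u ≡ M ℕ.* (3 ℕ.* u)
    triple = solve-∀
    weight≤ : m ℕ.* 3 ℕ.* weightOf w x ℕ.≤ m ℕ.* 3 ℕ.* (3 ℕ.* unit)
    weight≤ = ℕₚ.≤-trans (all≤ x) (ℕₚ.≤-reflexive (triple (m ℕ.* 3) unit))

  admissible : Admissible (real w)
  admissible = real-admissible w total>0
    -- The empty set contains no token, so `support` excludes a nonzero weight.
    (decidable-stable (w Sub.⊥ ℕ.≟ 0) (trace-∅ q ∘ support Sub.⊥)) w-∪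

  δ≤1/m : δ (real w) admissible ≤ fromℚ (1ℤ ℚ./ m)
  δ≤1/m = δ-bound (real w) admissible λ x k →
    ℚₚ.≤-trans (ℚₚ.≤-reflexive (seq-frequency w admissible x k)) (fraction≤ m total>0 (rare x))

≤-fromℚ : ∀ {x p q} → x ≤ fromℚ p → p ℚ.≤ q → x ≤ fromℚ q
≤-fromℚ x≤p p≤q ε ε>0 = let N , h = x≤p ε ε>0 in
  N , λ k N≤k → ℚₚ.≤-trans (h k N≤k) (ℚₚ.+-monoˡ-≤ ε p≤q)

p≤p+[n/d] : ∀ p n d .{{_ : ℕ.NonZero d}} → p ℚ.≤ p ℚ.+ + n ℚ./ d
p≤p+[n/d] p n d = subst (ℚ._≤ p ℚ.+ + n ℚ./ d) (ℚₚ.+-identityʳ p)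
  (ℚₚ.+-monoʳ-≤ p (ℚₚ.nonNegative⁻¹ (+ n ℚ./ d) {{ℚₚ.normalize-nonNeg n d}}))

theorem1p4 : (r m : ℕ) (r≥2 : r ℕ.≥ 2) (m≥1 : m ℕ.≥ 1) →
    let instance
          m≢0 : ℕ.NonZero m
          m≢0 = ℕ.>-nonZero m≥1
          mr≢0 : ℕ.NonZero (m ℕ.* r)
          mr≢0 = m*n≢0 m r {{m≢0}} {{ℕ.nonTrivial⇒nonZero r {{ℕ.n>1⇒nonTrivial r≥2}}}}
    in ∃[ n ] Σ[ w ∈ (Subset n → ℝ) ] Σ[ adm ∈ Admissible w ]
      δ w adm ≤ fromℚ (1ℤ ℚ./ m ℚ.+ (+ m ℤ.- 1ℤ) ℚ./ (m ℕ.* r))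
theorem1p4 r m@(suc m′) r≥2 m≥1 = _ , _ , admissible m L ,
  -- With `m = suc m′` the numerator `m - 1` computes to `m′`, so the second summand of the bound is
  -- a nonnegative fraction and only weakens `1/m`.
  ≤-fromℚ {δ _ (admissible m L)} (δ≤1/m m L) (p≤p+[n/d] (1ℤ ℚ./ m) m′ (m ℕ.* r))
  where
  instance
    mr≢0 : ℕ.NonZero (m ℕ.* r)
    mr≢0 = m*n≢0 m r {{_}} {{ℕ.nonTrivial⇒nonZero r {{ℕ.n>1⇒nonTrivial r≥2}}}}
  L : Layered (m ℕ.* 3) (m ℕ.* 3)
  -- `2 + m′ * 3` is the predecessor of `m * 3`; `layered` takes the number of rounds as a
  -- successor.
  L = layered (2 ℕ.+ m′ ℕ.* 3) (m ℕ.* 3) ℕₚ.≤-refl
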